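{- Every graph with two edge-disjoint spanning triangle-trees has flow index strictly less than $3$.
   Context: Graphs are finite, may contain parallel edges, but have no loops. Triangle-tree: a graph formed by starting with a triangle $x_1x_2x_3$ and then repeatedly (zero or more times) adding a new vertex $x_{j+1}$ joined to exactly two vertices $y,z$ that are adjacent in the graph already constructed (so $x_{j+1},y,z$ form a triangle). A spanning triangle-tree of $G$ is a subgraph of $G$ that is a triangle-tree and contains all vertices of $G$. Nowhere-zero $t$-flow: a pair $(D,f)$ where $D$ is an orientation of $G$ and $f:E(G)\to\{\pm1,\dots,\pm(t-1)\}$ satisfies $\sum_{e\in E_D^+(v)}f(e)=\sum_{e\in E_D^-(v)}f(e)$ for every vertex $v$, where $E_D^+(v)$, $E_D^-(v)$ are the sets of arcs leaving and entering $v$. For integers $t\ge 2s>0$, a circular $t/s$-flow of $G$ is a nowhere-zero $t$-flow $(D,f)$ with $s\le |f(e)|\le t-s$ for every edge $e$. The flow index of $G$ is the least rational number $r$ such that $G$ has a circular $r$-flow. -}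

module Defs where

open import Data.Bool using (Bool; if_then_else_)
open import Data.Fin using (Fin; _≟_)
open import Data.Fin.Subset using (Subset; _∈_; _∉_; _∪_; _∩_; ⁅_⁆; Empty)
open import Data.Integer using (ℤ; +_; 0ℤ; ∣_∣)
open import Data.Integer.Properties using (+-0-commutativeMonoid)
open import Data.Nat using (ℕ; NonZero; _∸_; _*_; _≤_; _<_)
open import Data.Product using (∃; _×_; _,_; proj₁; proj₂)
open import Data.Rational as ℚ using (ℚ; _/_)
open import Data.Sum using (_⊎_)
open import Relation.Binary.PropositionalEquality using (_≡_; _≢_)
open import Relation.Nullary using (does)
open import Algebra.Properties.CommutativeMonoid.Sum +-0-commutativeMonoid using (sum)

-- Finite loopless multigraphs.  The order of the pair `ends e` carries no
-- meaning: it only serves as a reference against which orientations are recorded.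
record Graph : Set where
  field
    ∣V∣ ∣E∣  : ℕ
    ends     : Fin ∣E∣ → Fin ∣V∣ × Fin ∣V∣
    loopless : ∀ e → proj₁ (ends e) ≢ proj₂ (ends e)

  Vertex Edge : Set
  Vertex = Fin ∣V∣
  Edge   = Fin ∣E∣

  Joins : Edge → Vertex → Vertex → Set
  Joins e x y = ends e ≡ (x , y) ⊎ ends e ≡ (y , x)

module _ (G : Graph) where
  open Graph G

  -- `TriangleTree V E`: the subgraph of G with vertex set V and edge set E is a
  -- triangle-tree.  Since G is loopless, joined vertices are distinct, so the
  -- three vertices of each triangle, and hence its three edges, are distinct.
  data TriangleTree : Subset ∣V∣ → Subset ∣E∣ → Set where
    triangle : ∀ {x₁ x₂ x₃ e₁₂ e₁₃ e₂₃} →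
      Joins e₁₂ x₁ x₂ → Joins e₁₃ x₁ x₃ → Joins e₂₃ x₂ x₃ →
      TriangleTree (⁅ x₁ ⁆ ∪ ⁅ x₂ ⁆ ∪ ⁅ x₃ ⁆) (⁅ e₁₂ ⁆ ∪ ⁅ e₁₃ ⁆ ∪ ⁅ e₂₃ ⁆)
    extend : ∀ {V E x y z e a b} →
      TriangleTree V E →
      e ∈ E → Joins e y z →
      x ∉ V → Joins a x y → Joins b x z →
      TriangleTree (V ∪ ⁅ x ⁆) (E ∪ ⁅ a ⁆ ∪ ⁅ b ⁆)

  SpanningTriangleTree : Subset ∣E∣ → Set
  SpanningTriangleTree E = ∃ λ V → TriangleTree V E × (∀ v → v ∈ V)

  TwoEdgeDisjointSpanningTriangleTrees : Set
  TwoEdgeDisjointSpanningTriangleTrees = ∃ λ E₁ → ∃ λ E₂ →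
    SpanningTriangleTree E₁ × SpanningTriangleTree E₂ × Empty (E₁ ∩ E₂)

  -- `true` keeps the reference order of `ends`, `false` reverses it.
  Orientation : Set
  Orientation = Edge → Bool

  tail head : Orientation → Edge → Vertex
  tail D e = if D e then proj₁ (ends e) else proj₂ (ends e)
  head D e = if D e then proj₂ (ends e) else proj₁ (ends e)

  outflow inflow : Orientation → (Edge → ℤ) → Vertex → ℤ
  outflow D f v = sum λ e → if does (tail D e ≟ v) then f e else 0ℤ
  inflow  D f v = sum λ e → if does (head D e ≟ v) then f e else 0ℤ

  record NowhereZeroFlow (t : ℕ) : Set where
    field
      D           : Orientation
      f           : Edge → ℤ
      nowhereZero : ∀ e → f e ≢ 0ℤ
      bounded     : ∀ e → ∣ f e ∣ < t
      balanced    : ∀ v → outflow D f v ≡ inflow D f v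

  record CircularFlow (t s : ℕ) : Set where
    field
      s>0  : 0 < s
      2s≤t : 2 * s ≤ t
      flow : NowhereZeroFlow t
    open NowhereZeroFlow flow public
    field
      lower : ∀ e → s ≤ ∣ f e ∣
      upper : ∀ e → ∣ f e ∣ ≤ t ∸ s

  -- The representation r = t / s need not be in lowest terms.
  record HasCircularFlow (r : ℚ) : Set where
    field
      t s          : ℕ
      ⦃ s-nonZero ⦄ : NonZero s
      r≡t/s        : r ≡ (+ t) / s
      circularFlow : CircularFlow t s

  IsFlowIndex : ℚ → Set
  IsFlowIndex r = HasCircularFlow r × (∀ q → HasCircularFlow q → r ℚ.≤ q)

{-# OPTIONS --safe #-}

-- Orient the edges by a nowhere-zero ℤ/3-flow. If the orientation is strong, it also
-- carries a positive integral circulation g, and the ℤ/3-flow lifts to an integral flow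
-- f with values 1 and −2 on it; then k f + g is a circular 3k/(k+1)-flow for large k.
--
-- For the ℤ/3-flow, let T₁ and T₂ be the trees on n vertices. T₂ is a directed triangle
-- followed by n − 3 ears y x z, each of which may be reversed, so T₂ stays strong while
-- its boundary runs through all sums of ±(y − z); every edge outside T₁ ∪ T₂ contributes
-- such a term as well. T₁ can absorb a boundary unless that boundary is a combination of
-- the n − 2 triangles of T₁ (as indicator vectors) with all coefficients nonzero. If this
-- happens for all choices of signs, then each triangle occurs in exactly one of the at
-- least n − 3 terms, while each term y − z involves at least two triangles. So there is
-- a term and 2 (n − 3) ≤ n − 2, which leaves only n = 4 without further edges.
module Submission where

open import Defs
open import Algebra.Bundles using (CommutativeRing; CommutativeSemiring)
import Algebra.Properties.CommutativeMonoid.Sum as MonoidSum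
import Algebra.Solver.CommutativeMonoid as CommutativeMonoidSolver
open import Data.Bool using (Bool; true; false; if_then_else_; _∧_; _∨_; _xor_; not)
open import Data.Fin using (Fin; zero; suc; _≟_)
open import Data.Fin.Properties using (any?)
open import Data.Fin.Subset
  using (Subset; inside; outside; _∈_; _∉_; _∪_; _∩_; ⁅_⁆; ∁; Empty) renaming (⊤ to full; ∣_∣ to card)
open import Data.Fin.Subset.Properties
  using (anySubset?; _∈?_; x∈⁅x⁆; x∈⁅y⁆⇒x≡y; x∈p∪q⁻; x∈p∪q⁺; x∈p∩q⁺; x∈∁p⇒x∉p; x∉p⇒x∈∁p;
         ∪-assoc; ∪-comm; ∪-identityʳ; ∪-commutativeMonoid; ∣⊤∣≡n; ∣p∣≤n; p⊆q⇒∣p∣≤∣q∣; ∣⁅x⁆∣≡1)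
open import Data.Integer as ℤ
  using (ℤ; +_; -[1+_]; 0ℤ; 1ℤ; -1ℤ; _+_; _-_; _*_; -_; _≤_; +≤+; ∣_∣)
import Data.Integer.Properties as ℤ
open import Data.Integer.Tactic.RingSolver using (solve-∀)
open import Data.List as List using (List; []; _∷_)
import Data.List.Extrema as Extrema
import Data.List.Membership.Propositional as ∈
open import Data.List.Membership.Propositional.Properties as ∈
  using (∈-++⁺ˡ; ∈-++⁺ʳ; ∈-map⁺; ∈-filter⁺)
open import Data.List.Relation.Unary.All as All using (All)
open import Data.List.Relation.Unary.All.Properties as All using (all-filter)
open import Data.List.Relation.Unary.AllPairs using ([]; _∷_)
open import Data.List.Relation.Unary.Any using (here; there)
open import Data.List.Relation.Unary.Unique.Propositional using (Unique)
open import Data.List.Relation.Unary.Unique.Propositional.Properties using (filter⁺; allFin⁺)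
open import Data.Nat as ℕ using (ℕ; zero; suc)
import Data.Nat.Properties as ℕ
open import Data.Nat.Tactic.RingSolver using () renaming (solve-∀ to ℕ-solve-∀)
open import Data.Product using (∃; _×_; _,_; proj₁; proj₂)
open import Data.Rational as ℚ using (ℚ; mkℚ; _<_; _/_)
import Data.Rational.Properties as ℚ
open import Data.Rational.Unnormalised using (mkℚᵘ; *≤*)
import Data.Rational.Unnormalised.Properties as ℚᵘ
open import Data.Sum as Sum using (_⊎_; inj₁; inj₂)
open import Data.Vec as Vec using (Vec; []; _∷_; lookup; tabulate)
open import Data.Vec.Properties as Vec using (lookup-zipWith; lookup∘tabulate)
open import Data.Vec.Relation.Unary.All using ([]; _∷_) renaming (All to VAll)
import Data.Vec.Relation.Unary.All.Properties as VAll
open import Function using (_∘_; case_of_)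
open import Level using (0ℓ)
open import Relation.Binary.Bundles using (DecTotalOrder)
open import Relation.Binary.Construct.Closure.ReflexiveTransitive as Star using (Star; ε; _◅_; _◅◅_)
open import Relation.Binary.PropositionalEquality
open import Relation.Nullary using (Dec; yes; no; does; contradiction)
open import Relation.Nullary.Decidable using (dec-true; ¬?; decidable-stable; _×-dec_; map′; from-yes)
open import Relation.Unary using (Decidable)

open import Algebra.Properties.Semiring.Sum (CommutativeRing.semiring ℤ.+-*-commutativeRing)
  using (sum; sum-cong-≗; ∑-distrib-+; ∑-comm; *-distribˡ-sum; sum-replicate-zero)

-- A ℤ/3-flow by itself only shows that 3 is an upper bound. Strong connectivity supplies the gap:
-- the values k and -2k lie at the two ends of the range [k, 2k] for the ratio 3k/k, and a positive
-- circulation moves both inwards by at least 1, which pays for raising the denominator to k + 1.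
--
-- The flow index must moreover be attained. By Hoffman's theorem a fixed orientation carries a
-- circular t/s-flow, where t ≥ 2s, exactly if s times the number of edges across X is at most t
-- times the number of edges leaving X, for all X. So the best ratio of a strong orientation is a
-- maximum over finitely many cuts, and the flow index is the least of these maxima over finitely
-- many orientations. The same theorem yields g and the integral lift f.
--
-- On four vertices the sign argument really breaks down: the only term of T₂ may be the difference
-- of the two triangles of T₁, which is bad with either sign. There T₂ is given a sink, and an edge
-- of T₁ leads out of it.

module ℕΣ = MonoidSum ℕ.+-0-commutativeMonoid

-- Integral flows with prescribed divergence (Hoffman's theorem)

≤-gap : ∀ {x y} d → x + + d ≡ y → x ≤ y
≤-gap {x} d refl = ℤ.i≤i+j x (+ d)

sum-mono-≤ : ∀ {n} {f g : Fin n → ℤ} → (∀ i → f i ≤ g i) → sum f ≤ sum g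
sum-mono-≤ {zero}  f≤g = ℤ.≤-refl
sum-mono-≤ {suc n} f≤g = ℤ.+-mono-≤ (f≤g zero) (sum-mono-≤ (f≤g ∘ suc))

sumℕ-mono-≤ : ∀ {n} {f g : Fin n → ℕ} → (∀ j → f j ℕ.≤ g j) → ℕΣ.sum f ℕ.≤ ℕΣ.sum g
sumℕ-mono-≤ {zero}  f≤g = ℕ.z≤n
sumℕ-mono-≤ {suc n} f≤g = ℕ.+-mono-≤ (f≤g zero) (sumℕ-mono-≤ (f≤g ∘ suc))

sumℕ-mono-< : ∀ {n} {f g : Fin n → ℕ} i → (∀ j → f j ℕ.≤ g j) → f i ℕ.< g i → ℕΣ.sum f ℕ.< ℕΣ.sum g
sumℕ-mono-< zero    f≤g f<g = ℕ.+-mono-<-≤ f<g (sumℕ-mono-≤ (f≤g ∘ suc))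
sumℕ-mono-< (suc i) f≤g f<g = ℕ.+-mono-≤-< (f≤g zero) (sumℕ-mono-< i (f≤g ∘ suc) f<g)

sum-zero : ∀ {n} {f : Fin n → ℤ} → (∀ i → f i ≡ 0ℤ) → sum f ≡ 0ℤ
sum-zero {n} f≗0 = trans (sum-cong-≗ f≗0) (sum-replicate-zero n)

sum-single : ∀ {n} (i : Fin n) (f : Fin n → ℤ) → sum (λ j → if does (i ≟ j) then f j else 0ℤ) ≡ f i
sum-single {suc n} zero    f = trans (cong (ℤ._+_ (f zero)) (sum-replicate-zero n)) (ℤ.+-identityʳ _)
sum-single (suc i) f = trans (ℤ.+-identityˡ _) (sum-single i (f ∘ suc))

sum-single′ : ∀ {n} (i : Fin n) (f : Fin n → ℤ) → sum (λ j → if does (j ≟ i) then f j else 0ℤ) ≡ f i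
sum-single′ {suc n} zero    f = trans (cong (ℤ._+_ (f zero)) (sum-replicate-zero n)) (ℤ.+-identityʳ _)
sum-single′ (suc i) f = trans (ℤ.+-identityˡ _) (sum-single′ i (f ∘ suc))

sum-neg : ∀ {n} (f : Fin n → ℤ) → sum (λ i → - f i) ≡ - sum f
sum-neg f = trans (sum-cong-≗ (λ i → sym (ℤ.-1*i≡-i (f i))))
  (trans (sym (*-distribˡ-sum -1ℤ f)) (ℤ.-1*i≡-i (sum f)))

-- The most that an edge with bounds `l` and `u` can add to the net flow out of a set; the Booleans
-- tell whether its tail and its head lie in the set.
cap : ℤ → ℤ → Bool → Bool → ℤ
cap u l true  false = u
cap u l false true  = - l
cap u l false false = 0ℤ
cap u l true  true  = 0ℤ

-- Submodularity of cut capacities, edge by edge. Intersection and union do better than the two sets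
-- only on an edge between their two differences, which adds u - l = k on the right and nothing on
-- the left.
cap-uncross : ∀ k l p q p′ q′ → let u = l + + k in
  cap u l (p ∧ p′) (q ∧ q′) + cap u l (p ∨ p′) (q ∨ q′) ≤ cap u l p q + cap u l p′ q′
cap-uncross k l false false p′ q′ = ℤ.≤-refl
cap-uncross k l true true p′ q′ = ℤ.≤-reflexive (ℤ.+-comm (cap _ l p′ q′) 0ℤ)
cap-uncross k l true false false false = ℤ.≤-reflexive (ℤ.+-comm 0ℤ (l + + k))
cap-uncross k l true false false true = ≤-gap k (x l (+ k))
  where
  x : ∀ l k → 0ℤ + 0ℤ + k ≡ l + k + - l
  x = solve-∀
cap-uncross k l true false true false = ℤ.≤-refl
cap-uncross k l true false true true = ℤ.≤-refl
cap-uncross k l false true false false = ℤ.≤-reflexive (ℤ.+-comm 0ℤ (- l))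
cap-uncross k l false true false true = ℤ.≤-refl
cap-uncross k l false true true false = ≤-gap k (x l (+ k))
  where
  x : ∀ l k → 0ℤ + 0ℤ + k ≡ - l + (l + k)
  x = solve-∀
cap-uncross k l false true true true = ℤ.≤-refl

-- Here the upper bound of the edge was lowered on one side and its lower bound
-- raised on the other; each costs at most 1, and both are only paid when the
-- uncrossing gains at least 1.
cap-uncross-tight : ∀ k l p q p′ q′ → let u = l + + suc k in
  cap u l (p ∧ p′) (q ∧ q′) + cap u l (p ∨ p′) (q ∨ q′) ≤
  cap (l + + k) l p q + cap (1ℤ + l + + k) (1ℤ + l) p′ q′ + 1ℤ
cap-uncross-tight k l false false false false = ≤-gap 1 (eq l (+ k))
  where
  eq : ∀ l k → 0ℤ + 0ℤ + + 1 ≡ 0ℤ + 0ℤ + 1ℤ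
  eq = solve-∀
cap-uncross-tight k l false false false true = ≤-gap 0 (eq l (+ k))
  where
  eq : ∀ l k → 0ℤ + - l + + 0 ≡ 0ℤ + - (1ℤ + l) + 1ℤ
  eq = solve-∀
cap-uncross-tight k l false false true false = ≤-gap 1 (eq l (+ k))
  where
  eq : ∀ l k → 0ℤ + (l + (1ℤ + k)) + + 1 ≡ 0ℤ + (1ℤ + l + k) + 1ℤ
  eq = solve-∀
cap-uncross-tight k l false false true true = ≤-gap 1 (eq l (+ k))
  where
  eq : ∀ l k → 0ℤ + 0ℤ + + 1 ≡ 0ℤ + 0ℤ + 1ℤ
  eq = solve-∀
cap-uncross-tight k l false true false false = ≤-gap 1 (eq l (+ k))
  where
  eq : ∀ l k → 0ℤ + - l + + 1 ≡ - l + 0ℤ + 1ℤ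
  eq = solve-∀
cap-uncross-tight k l false true false true = ≤-gap 0 (eq l (+ k))
  where
  eq : ∀ l k → - l + - l + + 0 ≡ - l + - (1ℤ + l) + 1ℤ
  eq = solve-∀
cap-uncross-tight k l false true true false = ≤-gap (2 ℕ.+ k) (eq l (+ k))
  where
  eq : ∀ l k → 0ℤ + 0ℤ + (+ 2 + k) ≡ - l + (1ℤ + l + k) + 1ℤ
  eq = solve-∀
cap-uncross-tight k l false true true true = ≤-gap 1 (eq l (+ k))
  where
  eq : ∀ l k → - l + 0ℤ + + 1 ≡ - l + 0ℤ + 1ℤ
  eq = solve-∀
cap-uncross-tight k l true false false false = ≤-gap 0 (eq l (+ k))
  where
  eq : ∀ l k → 0ℤ + (l + (1ℤ + k)) + + 0 ≡ (l + k) + 0ℤ + 1ℤ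
  eq = solve-∀
cap-uncross-tight k l true false false true = ≤-gap k (eq l (+ k))
  where
  eq : ∀ l k → 0ℤ + 0ℤ + k ≡ (l + k) + - (1ℤ + l) + 1ℤ
  eq = solve-∀
cap-uncross-tight k l true false true false = ≤-gap 0 (eq l (+ k))
  where
  eq : ∀ l k → (l + (1ℤ + k)) + (l + (1ℤ + k)) + + 0 ≡ (l + k) + (1ℤ + l + k) + 1ℤ
  eq = solve-∀
cap-uncross-tight k l true false true true = ≤-gap 0 (eq l (+ k))
  where
  eq : ∀ l k → (l + (1ℤ + k)) + 0ℤ + + 0 ≡ (l + k) + 0ℤ + 1ℤ
  eq = solve-∀
cap-uncross-tight k l true true false false = ≤-gap 1 (eq l (+ k))
  where
  eq : ∀ l k → 0ℤ + 0ℤ + + 1 ≡ 0ℤ + 0ℤ + 1ℤ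
  eq = solve-∀
cap-uncross-tight k l true true false true = ≤-gap 0 (eq l (+ k))
  where
  eq : ∀ l k → - l + 0ℤ + + 0 ≡ 0ℤ + - (1ℤ + l) + 1ℤ
  eq = solve-∀
cap-uncross-tight k l true true true false = ≤-gap 1 (eq l (+ k))
  where
  eq : ∀ l k → (l + (1ℤ + k)) + 0ℤ + + 1 ≡ 0ℤ + (1ℤ + l + k) + 1ℤ
  eq = solve-∀
cap-uncross-tight k l true true true true = ≤-gap 1 (eq l (+ k))
  where
  eq : ∀ l k → 0ℤ + 0ℤ + + 1 ≡ 0ℤ + 0ℤ + 1ℤ
  eq = solve-∀

dem : ℤ → Bool → ℤ
dem b p = if p then b else 0ℤ

dem-modular : ∀ b p p′ → dem b (p ∧ p′) + dem b (p ∨ p′) ≡ dem b p + dem b p′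
dem-modular b true  p′ = ℤ.+-comm (dem b p′) b
dem-modular b false p′ = refl

module Hoffman {m n : ℕ} (tl hd : Fin m → Fin n) where

  div : (Fin m → ℤ) → Fin n → ℤ
  div f v = sum λ e → f e * ((if does (tl e ≟ v) then 1ℤ else 0ℤ) - (if does (hd e ≟ v) then 1ℤ else 0ℤ))

  cutCap : (u l : Fin m → ℤ) → Subset n → ℤ
  cutCap u l X = sum λ e → cap (u e) (l e) (lookup X (tl e)) (lookup X (hd e))

  demand : (Fin n → ℤ) → Subset n → ℤ
  demand b X = sum λ v → dem (b v) (lookup X v)

  -- Upper bounds are stored as `l` plus a natural width: this builds in that they are at least `l`,
  -- and the total width is the measure of the induction in `hoffman`.
  CutCondition : (l : Fin m → ℤ) (w : Fin m → ℕ) (b : Fin n → ℤ) → Set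
  CutCondition l w b = ∀ X → demand b X ≤ cutCap (λ e → l e + + w e) l X

  Feasible : (l : Fin m → ℤ) (w : Fin m → ℕ) (b : Fin n → ℤ) → Set
  Feasible l w b = ∃ λ f → (∀ e → l e ≤ f e × f e ≤ l e + + w e) × (∀ v → div f v ≡ b v)

  lower : Fin m → (Fin m → ℕ) → Fin m → ℕ
  lower e w e′ = if does (e ≟ e′) then ℕ.pred (w e′) else w e′

  raise : Fin m → (Fin m → ℤ) → Fin m → ℤ
  raise e l e′ = if does (e ≟ e′) then 1ℤ + l e′ else l e′

  cutCondition? : ∀ l w b → CutCondition l w b ⊎ ∃ λ X → cutCap (λ e → l e + + w e) l X ℤ.< demand b X
  cutCondition? l w b with anySubset? (λ X → cutCap (λ e → l e + + w e) l X ℤ.<? demand b X)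
  ... | yes bad = inj₂ bad
  ... | no ¬bad = inj₁ λ X → ℤ.≮⇒≥ λ lt → ¬bad (X , lt)

  module _ (l : Fin m → ℤ) (w : Fin m → ℕ) (b : Fin n → ℤ) (cut : CutCondition l w b)
           (e₀ : Fin m) (k : ℕ) (w≡ : w e₀ ≡ suc k) where

    private
      u uA uB : Fin m → ℤ
      u e = l e + + w e
      uA e = l e + + lower e₀ w e
      uB e = raise e₀ l e + + lower e₀ w e
      one : Fin m → ℤ
      one e = if does (e₀ ≟ e) then 1ℤ else 0ℤ

    uncross-edge : ∀ X Y e →
      cap (u e) (l e) (lookup (X ∩ Y) (tl e)) (lookup (X ∩ Y) (hd e)) +
      cap (u e) (l e) (lookup (X ∪ Y) (tl e)) (lookup (X ∪ Y) (hd e)) ≤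
      cap (uA e) (l e) (lookup X (tl e)) (lookup X (hd e)) +
      cap (uB e) (raise e₀ l e) (lookup Y (tl e)) (lookup Y (hd e)) + one e
    uncross-edge X Y e
      rewrite lookup-zipWith _∧_ (tl e) X Y | lookup-zipWith _∧_ (hd e) X Y
            | lookup-zipWith _∨_ (tl e) X Y | lookup-zipWith _∨_ (hd e) X Y
      with e₀ ≟ e
    ... | yes refl rewrite w≡ = cap-uncross-tight k (l e) (lookup X (tl e)) _ (lookup Y (tl e)) _
    ... | no  _    = ℤ.≤-trans (cap-uncross (w e) (l e) (lookup X (tl e)) _ (lookup Y (tl e)) _)
                               (ℤ.≤-reflexive (sym (ℤ.+-identityʳ _)))

    uncross : ∀ X Y →
      cutCap u l (X ∩ Y) + cutCap u l (X ∪ Y) ≤ cutCap uA l X + cutCap uB (raise e₀ l) Y + 1ℤ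
    uncross X Y = begin
      cutCap u l (X ∩ Y) + cutCap u l (X ∪ Y)
        ≡⟨ ∑-distrib-+ (λ e → cap (u e) (l e) (lookup (X ∩ Y) (tl e)) (lookup (X ∩ Y) (hd e))) _ ⟨
      _ ≤⟨ sum-mono-≤ (uncross-edge X Y) ⟩
      _ ≡⟨ ∑-distrib-+ (λ e → cap (uA e) (l e) (lookup X (tl e)) (lookup X (hd e)) +
             cap (uB e) (raise e₀ l e) (lookup Y (tl e)) (lookup Y (hd e))) one ⟩
      _ ≡⟨ cong₂ _+_ (∑-distrib-+ (λ e → cap (uA e) (l e) (lookup X (tl e)) (lookup X (hd e))) _)
                     (sum-single e₀ (λ _ → 1ℤ)) ⟩
      cutCap uA l X + cutCap uB (raise e₀ l) Y + 1ℤ ∎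
      where open ℤ.≤-Reasoning

    demand-modular : ∀ X Y → demand b (X ∩ Y) + demand b (X ∪ Y) ≡ demand b X + demand b Y
    demand-modular X Y =
      trans (sym (∑-distrib-+ (λ v → dem (b v) (lookup (X ∩ Y) v)) _))
      (trans (sum-cong-≗ pointwise) (∑-distrib-+ (λ v → dem (b v) (lookup X v)) _))
      where
      pointwise : ∀ v → dem (b v) (lookup (X ∩ Y) v) + dem (b v) (lookup (X ∪ Y) v)
                      ≡ dem (b v) (lookup X v) + dem (b v) (lookup Y v)
      pointwise v rewrite lookup-zipWith _∧_ v X Y | lookup-zipWith _∨_ v X Y =
        dem-modular (b v) (lookup X v) (lookup Y v)

    -- If both ways of narrowing the interval of `e₀` failed, at `X` and at `Y`, the two violations
    -- would amount to at least 2 by integrality. Uncrossing `X` and `Y` loses at most 1, so the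
    -- original condition would fail at `X ∩ Y` or at `X ∪ Y`.
    shrink : CutCondition l (lower e₀ w) b ⊎ CutCondition (raise e₀ l) (lower e₀ w) b
    shrink with cutCondition? l (lower e₀ w) b | cutCondition? (raise e₀ l) (lower e₀ w) b
    ... | inj₁ ok       | _             = inj₁ ok
    ... | inj₂ _        | inj₁ ok       = inj₂ ok
    ... | inj₂ (X , ltX) | inj₂ (Y , ltY) = contradiction lt (ℤ.<-irrefl refl)
      where
      open ℤ.≤-Reasoning
      lt : demand b X + demand b Y + 1ℤ ℤ.< demand b X + demand b Y + 1ℤ
      lt = begin-strict
        demand b X + demand b Y + 1ℤ ≡⟨ cong (ℤ._+ 1ℤ) (sym (demand-modular X Y)) ⟩
        demand b (X ∩ Y) + demand b (X ∪ Y) + 1ℤ ≤⟨ ℤ.+-monoˡ-≤ 1ℤ (ℤ.+-mono-≤ (cut (X ∩ Y)) (cut (X ∪ Y))) ⟩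
        cutCap u l (X ∩ Y) + cutCap u l (X ∪ Y) + 1ℤ ≤⟨ ℤ.+-monoˡ-≤ 1ℤ (uncross X Y) ⟩
        cutCap uA l X + cutCap uB (raise e₀ l) Y + 1ℤ + 1ℤ ≡⟨ eq (cutCap uA l X) _ ⟩
        (1ℤ + cutCap uA l X) + (1ℤ + cutCap uB (raise e₀ l) Y) ≤⟨ ℤ.+-mono-≤ (ℤ.i<j⇒suc[i]≤j ltX) (ℤ.i<j⇒suc[i]≤j ltY) ⟩
        demand b X + demand b Y <⟨ ℤ.suc[i]≤j⇒i<j (ℤ.≤-refl {1ℤ + (demand b X + demand b Y)}) ⟩
        1ℤ + (demand b X + demand b Y) ≡⟨ ℤ.+-comm 1ℤ (demand b X + demand b Y) ⟩
        demand b X + demand b Y + 1ℤ ∎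
        where
        eq : ∀ x y → x + y + 1ℤ + 1ℤ ≡ (1ℤ + x) + (1ℤ + y)
        eq = solve-∀

  -- Discrete divergence theorem: with equal bounds the capacity is the net flow of `f` out of `X`.
  -- After exchanging the sums, the two ends of an edge inside `X` cancel.
  demand-div : ∀ f X → demand (div f) X ≡ cutCap f f X
  demand-div f X = begin
    demand (div f) X                                        ≡⟨ sum-cong-≗ (λ v → dem-sum (lookup X v) (λ e → term e v)) ⟩
    sum (λ v → sum (λ e → dem (term e v) (lookup X v)))     ≡⟨ ∑-comm (λ v e → dem (term e v) (lookup X v)) ⟩
    sum (λ e → sum (λ v → dem (term e v) (lookup X v)))     ≡⟨ sum-cong-≗ edge ⟩
    cutCap f f X                                            ∎
    where
    open ≡-Reasoning
    term : Fin m → Fin n → ℤ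
    term e v = f e * ((if does (tl e ≟ v) then 1ℤ else 0ℤ) - (if does (hd e ≟ v) then 1ℤ else 0ℤ))
    dem-sum : ∀ {k} p (g : Fin k → ℤ) → dem (sum g) p ≡ sum (λ e → dem (g e) p)
    dem-sum     true  g = refl
    dem-sum {k} false g = sym (sum-replicate-zero k)
    split : ∀ x p q r → dem (x * ((if p then 1ℤ else 0ℤ) - (if q then 1ℤ else 0ℤ))) r
                      ≡ (if p then dem x r else 0ℤ) + - (if q then dem x r else 0ℤ)
    split x true  true  true  = trans (ℤ.*-zeroʳ x) (sym (ℤ.+-inverseʳ x))
    split x true  false true  = trans (ℤ.*-identityʳ x) (sym (ℤ.+-identityʳ x))
    split x false true  true  = trans (trans (ℤ.*-comm x -1ℤ) (ℤ.-1*i≡-i x)) (sym (ℤ.+-identityˡ (- x)))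
    split x false false true  = ℤ.*-zeroʳ x
    split x true  true  false = refl
    split x true  false false = refl
    split x false true  false = refl
    split x false false false = refl
    join : ∀ x p q → dem x p + - dem x q ≡ cap x x p q
    join x true  true  = ℤ.+-inverseʳ x
    join x true  false = ℤ.+-identityʳ x
    join x false true  = ℤ.+-identityˡ (- x)
    join x false false = refl
    edge : ∀ e → sum (λ v → dem (term e v) (lookup X v)) ≡ cap (f e) (f e) (lookup X (tl e)) (lookup X (hd e))
    edge e = trans (sum-cong-≗ λ v → split (f e) (does (tl e ≟ v)) (does (hd e ≟ v)) (lookup X v))
      (trans (∑-distrib-+ (λ v → if does (tl e ≟ v) then dem (f e) (lookup X v) else 0ℤ) _)
      (trans (cong₂ _+_ (sum-single (tl e) (λ v → dem (f e) (lookup X v)))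
               (trans (sum-neg (λ v → if does (hd e ≟ v) then dem (f e) (lookup X v) else 0ℤ))
                      (cong -_ (sum-single (hd e) (λ v → dem (f e) (lookup X v))))))
             (join (f e) (lookup X (tl e)) (lookup X (hd e)))))

  cap-tight : ∀ x k p q → k ≡ 0 →
    cap (x + + k) x p q ≡ x * ((if p then 1ℤ else 0ℤ) - (if q then 1ℤ else 0ℤ))
  cap-tight x _ true  true  refl = sym (ℤ.*-zeroʳ x)
  cap-tight x _ true  false refl = trans (ℤ.+-identityʳ x) (sym (ℤ.*-identityʳ x))
  cap-tight x _ false true  refl = trans (sym (ℤ.-1*i≡-i x)) (ℤ.*-comm -1ℤ x)
  cap-tight x _ false false refl = sym (ℤ.*-zeroʳ x)

  module _ (l : Fin m → ℤ) (w : Fin m → ℕ) (b : Fin n → ℤ) (w≡0 : ∀ e → w e ≡ 0) (v : Fin n) where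

    private
      S S′ : Subset n
      S  = tabulate λ x → does (x ≟ v)
      S′ = tabulate λ x → not (does (x ≟ v))

    demand-singleton : demand b S ≡ b v
    demand-singleton = trans
      (sum-cong-≗ λ x → cong (dem (b x)) (lookup∘tabulate (λ x → does (x ≟ v)) x)) (sum-single′ v b)

    demand-cosingleton : sum b ≡ 0ℤ → demand b S′ ≡ - b v
    demand-cosingleton ∑b≡0 = begin
      demand b S′ ≡⟨ sum-cong-≗ pointwise ⟩
      _           ≡⟨ ∑-distrib-+ b _ ⟩
      _           ≡⟨ cong₂ _+_ ∑b≡0 (trans (sum-neg (λ x → dem (b x) (does (x ≟ v)))) (cong -_ (sum-single′ v b))) ⟩
      0ℤ - b v    ≡⟨ ℤ.+-identityˡ _ ⟩
      - b v       ∎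
      where
      open ≡-Reasoning
      pointwise : ∀ x → dem (b x) (lookup S′ x) ≡ b x - dem (b x) (does (x ≟ v))
      pointwise x rewrite lookup∘tabulate (λ x → not (does (x ≟ v))) x with does (x ≟ v)
      ... | true  = sym (ℤ.+-inverseʳ (b x))
      ... | false = sym (ℤ.+-identityʳ (b x))

    cutCap-singleton : cutCap (λ e → l e + + w e) l S ≡ div l v
    cutCap-singleton = sum-cong-≗ λ e → trans
      (cong₂ (cap _ (l e)) (lookup∘tabulate _ (tl e)) (lookup∘tabulate _ (hd e)))
      (cap-tight (l e) (w e) (does (tl e ≟ v)) (does (hd e ≟ v)) (w≡0 e))

    cutCap-cosingleton : cutCap (λ e → l e + + w e) l S′ ≡ - div l v
    cutCap-cosingleton = trans (sum-cong-≗ pointwise) (sum-neg (λ e → l e * ((if does (tl e ≟ v) then 1ℤ else 0ℤ) - (if does (hd e ≟ v) then 1ℤ else 0ℤ))))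
      where
      swap : ∀ x a b → x * (a - b) ≡ - (x * (b - a))
      swap = solve-∀
      flip : ∀ x p q → x * ((if not p then 1ℤ else 0ℤ) - (if not q then 1ℤ else 0ℤ))
                     ≡ - (x * ((if p then 1ℤ else 0ℤ) - (if q then 1ℤ else 0ℤ)))
      flip x true  true  = swap x 0ℤ 0ℤ
      flip x true  false = swap x 0ℤ 1ℤ
      flip x false true  = swap x 1ℤ 0ℤ
      flip x false false = swap x 1ℤ 1ℤ
      pointwise : ∀ e → cap (l e + + w e) (l e) (lookup S′ (tl e)) (lookup S′ (hd e)) ≡ _
      pointwise e = trans
        (cong₂ (cap _ (l e)) (lookup∘tabulate _ (tl e)) (lookup∘tabulate _ (hd e)))
        (trans (cap-tight (l e) (w e) (not (does (tl e ≟ v))) (not (does (hd e ≟ v))) (w≡0 e))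
               (flip (l e) (does (tl e ≟ v)) (does (hd e ≟ v))))

    -- At width zero only `l` itself is left. The cut conditions at the set of `v` alone and at its
    -- complement bound `div l v` from below and from above; the second one needs that `b` sums to
    -- zero.
    tight-div : sum b ≡ 0ℤ → CutCondition l w b → div l v ≡ b v
    tight-div ∑b≡0 cut = ℤ.≤-antisym
      (ℤ.neg-cancel-≤ (subst₂ _≤_ (demand-cosingleton ∑b≡0) cutCap-cosingleton (cut S′)))
      (subst₂ _≤_ demand-singleton cutCap-singleton (cut S))

  -- No augmenting paths: the intervals are narrowed one unit at a time, always keeping the cut
  -- condition, until each is a single integer. Integrality of the flow is thus automatic.
  hoffman : ∀ l w b → sum b ≡ 0ℤ → CutCondition l w b → Feasible l w b
  hoffman l w b ∑b≡0 = go (ℕΣ.sum w) l w ℕ.≤-refl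
    where
    go : ∀ N l w → ℕΣ.sum w ℕ.≤ N → CutCondition l w b → Feasible l w b
    descend : ∀ N l w e k → w e ≡ suc k → ℕΣ.sum w ℕ.≤ N → CutCondition l w b → Feasible l w b

    go N l w ∑w≤N cut with any? (λ e → ¬? (w e ℕ.≟ 0))
    ... | no ¬slack = l , (λ e → ℤ.≤-refl , ℤ.i≤i+j (l e) (+ w e)) ,
                      λ v → tight-div l w b (λ e → decidable-stable (w e ℕ.≟ 0) λ w≢0 → ¬slack (e , w≢0)) v ∑b≡0 cut
    ... | yes (e , w≢0) with w e in w≡
    ...   | zero  = contradiction refl w≢0
    ...   | suc k = descend N l w e k w≡ ∑w≤N cut

    descend N l w e k w≡ ∑w≤N cut with ℕ.<-≤-trans (sumℕ-mono-< e lower≤ lower<) ∑w≤N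
      where
      lower≤ : ∀ e′ → lower e w e′ ℕ.≤ w e′
      lower≤ e′ with does (e ≟ e′)
      ... | true  = ℕ.pred[n]≤n
      ... | false = ℕ.≤-refl
      lower< : lower e w e ℕ.< w e
      lower< rewrite dec-true (e ≟ e) refl | w≡ = ℕ.≤-refl
    descend (suc N) l w e k w≡ ∑w≤N cut | ℕ.s≤s ∑′≤N with shrink l w b cut e k w≡
    ... | inj₁ cut′ = let (f , bds , div≡) = go N l (lower e w) ∑′≤N cut′ in
      f , (λ e′ → proj₁ (bds e′) , ℤ.≤-trans (proj₂ (bds e′)) (up e′)) , div≡
      where
      up : ∀ e′ → l e′ + + lower e w e′ ≤ l e′ + + w e′
      up e′ with does (e ≟ e′)
      ... | true  = ℤ.+-monoʳ-≤ (l e′) (+≤+ ℕ.pred[n]≤n)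
      ... | false = ℤ.≤-refl
    ... | inj₂ cut′ = let (f , bds , div≡) = go N (raise e l) (lower e w) ∑′≤N cut′ in
      f , (λ e′ → ℤ.≤-trans (low e′) (proj₁ (bds e′)) , ℤ.≤-trans (proj₂ (bds e′)) (up e′)) , div≡
      where
      low : ∀ e′ → l e′ ≤ raise e l e′
      low e′ with does (e ≟ e′)
      ... | true  = ℤ.i≤suc[i] (l e′)
      ... | false = ℤ.≤-refl
      up : ∀ e′ → raise e l e′ + + lower e w e′ ≤ l e′ + + w e′
      up e′ with e ≟ e′
      ... | no  _    = ℤ.≤-refl
      ... | yes refl rewrite w≡ = ℤ.≤-reflexive (eq (l e) (+ k))
        where
        eq : ∀ l k → 1ℤ + l + k ≡ l + (1ℤ + k)
        eq = solve-∀

-- Existence of the flow index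

+-sum : ∀ {n} (f : Fin n → ℕ) → sum (λ i → + f i) ≡ + ℕΣ.sum f
+-sum {zero}  f = refl
+-sum {suc n} f = cong (ℤ._+_ (+ f zero)) (+-sum (f ∘ suc))

module Cuts {m n : ℕ} (tl hd : Fin m → Fin n) where
  open Hoffman tl hd

  leaves crosses : Bool → Bool → ℕ
  leaves  p q = if p ∧ not q then 1 else 0
  crosses p q = if p xor q then 1 else 0

  outs cuts : Subset n → Fin m → ℕ
  outs X e = leaves  (lookup X (tl e)) (lookup X (hd e))
  cuts X e = crosses (lookup X (tl e)) (lookup X (hd e))

  outSize cutSize : Subset n → ℕ
  outSize X = ℕΣ.sum (outs X)
  cutSize X = ℕΣ.sum (cuts X)

  -- Since the crossing edges are those leaving and those entering, this says s · in ≤ (t - s) ·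
  -- out, Hoffman's condition for a circulation with values in [s, t - s]. In this form the cut
  -- bounds t/s from below by `cutSize X` over `outSize X`.
  CutBound : ℕ → ℕ → Set
  CutBound t s = ∀ X → s ℕ.* cutSize X ℕ.≤ t ℕ.* outSize X

  weighted : ∀ x (a : Fin m → ℕ) → sum (λ e → + x * + a e) ≡ + (x ℕ.* ℕΣ.sum a)
  weighted x a = trans (sym (*-distribˡ-sum (+ x) (+_ ∘ a)))
    (trans (cong (+ x *_) (+-sum a)) (sym (ℤ.pos-* x _)))

  cutBound⇒flow : ∀ s w → CutBound (s ℕ.+ (s ℕ.+ w)) s → Feasible (λ _ → + s) (λ _ → w) (λ _ → 0ℤ)
  cutBound⇒flow s w bound = hoffman _ _ _ (sum-replicate-zero n) λ X → begin
    demand (λ _ → 0ℤ) X   ≡⟨ sum-zero (λ v → dem-0 (lookup X v)) ⟩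
    0ℤ                    ≤⟨ ℤ.i≤j⇒0≤j-i (+≤+ (bound X)) ⟩
    + (t ℕ.* outSize X) - + (s ℕ.* cutSize X)
      ≡⟨ cong₂ _-_ (sym (weighted t (outs X))) (sym (weighted s (cuts X))) ⟩
    sum (λ e → + t * + outs X e) - sum (λ e → + s * + cuts X e)
      ≡⟨ cong (ℤ._+_ (sum λ e → + t * + outs X e)) (sym (sum-neg (λ e → + s * + cuts X e))) ⟩
    sum (λ e → + t * + outs X e) + sum (λ e → - (+ s * + cuts X e))
      ≡⟨ ∑-distrib-+ (λ e → + t * + outs X e) (λ e → - (+ s * + cuts X e)) ⟨
    sum (λ e → + t * + outs X e - + s * + cuts X e)
      ≡⟨ sum-cong-≗ (λ e → edge (lookup X (tl e)) (lookup X (hd e))) ⟩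
    cutCap (λ _ → + s + + w) (λ _ → + s) X ∎
    where
    open ℤ.≤-Reasoning
    t = s ℕ.+ (s ℕ.+ w)
    dem-0 : ∀ p → dem 0ℤ p ≡ 0ℤ
    dem-0 true  = refl
    dem-0 false = refl
    edge : ∀ p q → + t * + leaves p q - + s * + crosses p q ≡ cap (+ s + + w) (+ s) p q
    edge true  true  = cong₂ _-_ (ℤ.*-zeroʳ (+ t)) (ℤ.*-zeroʳ (+ s))
    edge true  false = eq (+ s) (+ w)
      where
      eq : ∀ s w → (s + (s + w)) * 1ℤ - s * 1ℤ ≡ s + w
      eq = solve-∀
    edge false true  = eq (+ s) (+ w)
      where
      eq : ∀ s w → (s + (s + w)) * 0ℤ - s * 1ℤ ≡ - s
      eq = solve-∀
    edge false false = cong₂ _-_ (ℤ.*-zeroʳ (+ t)) (ℤ.*-zeroʳ (+ s))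

  flow⇒cutBound : ∀ t s (g : Fin m → ℕ) → (∀ e → s ℕ.≤ g e) → (∀ e → s ℕ.+ g e ℕ.≤ t) →
    (∀ v → div (+_ ∘ g) v ≡ 0ℤ) → CutBound t s
  flow⇒cutBound t s g s≤g g≤t-s div≡0 X = ℤ.drop‿+≤+ (begin
    + (s ℕ.* cutSize X)      ≡⟨ ℤ.+-identityʳ _ ⟨
    + (s ℕ.* cutSize X) + 0ℤ
      ≡⟨ cong₂ _+_ (sym (weighted s (cuts X)))
                   (trans (sym (sum-zero λ v → dem-0 (div≡0 v) (lookup X v))) (demand-div (+_ ∘ g) X)) ⟩
    sum (λ e → + s * + cuts X e) + cutCap (+_ ∘ g) (+_ ∘ g) X
      ≡⟨ ∑-distrib-+ (λ e → + s * + cuts X e) (λ e → cap (+ g e) (+ g e) (lookup X (tl e)) (lookup X (hd e))) ⟨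
    sum (λ e → + s * + cuts X e + cap (+ g e) (+ g e) (lookup X (tl e)) (lookup X (hd e)))
      ≤⟨ sum-mono-≤ (λ e → edge (g e) (s≤g e) (g≤t-s e) (lookup X (tl e)) (lookup X (hd e))) ⟩
    sum (λ e → + t * + outs X e)
      ≡⟨ weighted t (outs X) ⟩
    + (t ℕ.* outSize X) ∎)
    where
    open ℤ.≤-Reasoning
    dem-0 : ∀ {x} → x ≡ 0ℤ → ∀ p → dem x p ≡ 0ℤ
    dem-0 refl true  = refl
    dem-0 refl false = refl
    edge : ∀ g → s ℕ.≤ g → s ℕ.+ g ℕ.≤ t → ∀ p q →
      + s * + crosses p q + cap (+ g) (+ g) p q ≤ + t * + leaves p q
    edge g s≤g s+g≤t true  false =
      subst₂ _≤_ (cong (_+ (+ g)) (sym (ℤ.*-identityʳ (+ s)))) (sym (ℤ.*-identityʳ (+ t))) (+≤+ s+g≤t)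
    edge g s≤g s+g≤t false true  =
      subst₂ _≤_ (cong (_- (+ g)) (sym (ℤ.*-identityʳ (+ s)))) (sym (ℤ.*-zeroʳ (+ t))) (ℤ.i≤j⇒i-j≤0 (+≤+ s≤g))
    edge g s≤g s+g≤t true  true  = ℤ.≤-reflexive (trans (cong (_+ 0ℤ) (ℤ.*-zeroʳ (+ s))) (sym (ℤ.*-zeroʳ (+ t))))
    edge g s≤g s+g≤t false false = ℤ.≤-reflexive (trans (cong (_+ 0ℤ) (ℤ.*-zeroʳ (+ s))) (sym (ℤ.*-zeroʳ (+ t))))

allSubsets : ∀ n → List (Subset n)
allSubsets zero    = [] ∷ []
allSubsets (suc n) = List.map (inside ∷_) (allSubsets n) List.++ List.map (outside ∷_) (allSubsets n)

∈-allSubsets : ∀ {n} (X : Subset n) → X ∈.∈ allSubsets n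
∈-allSubsets []            = here refl
∈-allSubsets (inside  ∷ X) = ∈-++⁺ˡ (∈-map⁺ (inside ∷_) (∈-allSubsets X))
∈-allSubsets (outside ∷ X) = ∈-++⁺ʳ _ (∈-map⁺ (outside ∷_) (∈-allSubsets X))

/-mono-≤ : ∀ a b c d → a ℕ.* suc d ℕ.≤ c ℕ.* suc b → (+ a) / suc b ℚ.≤ (+ c) / suc d
/-mono-≤ a b c d le = ℚ.toℚᵘ-cancel-≤
  (ℚᵘ.≤-respˡ-≃ (ℚᵘ.≃-sym (ℚ.toℚᵘ-fromℚᵘ (mkℚᵘ (+ a) b)))
  (ℚᵘ.≤-respʳ-≃ (ℚᵘ.≃-sym (ℚ.toℚᵘ-fromℚᵘ (mkℚᵘ (+ c) d)))
  (*≤* (subst₂ _≤_ (ℤ.pos-* a (suc d)) (ℤ.pos-* c (suc b)) (+≤+ le)))))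

/-cancel-≤ : ∀ a b c d → (+ a) / suc b ℚ.≤ (+ c) / suc d → a ℕ.* suc d ℕ.≤ c ℕ.* suc b
/-cancel-≤ a b c d le with
  ℚᵘ.≤-respˡ-≃ (ℚ.toℚᵘ-fromℚᵘ (mkℚᵘ (+ a) b))
  (ℚᵘ.≤-respʳ-≃ (ℚ.toℚᵘ-fromℚᵘ (mkℚᵘ (+ c) d)) (ℚ.toℚᵘ-mono-≤ le))
... | *≤* le′ = ℤ.drop‿+≤+ (subst₂ _≤_ (sym (ℤ.pos-* a (suc d))) (sym (ℤ.pos-* c (suc b))) le′)

/-mono-< : ∀ a b c d → a ℕ.* suc d ℕ.< c ℕ.* suc b → (+ a) / suc b ℚ.< (+ c) / suc d
/-mono-< a b c d lt = ℚ.≰⇒> λ le → ℕ.<⇒≱ lt (/-cancel-≤ c d a b le)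

2ℚ : ℚ
2ℚ = (+ 2) / 1

open Extrema (DecTotalOrder.totalOrder ℚ.≤-decTotalOrder)
  using (argmin; f[argmin]≤f[xs]; argmin-all; max; xs≤max; ⊥≤max; max≤v⁺)

module FlowIndex (G : Graph) where
  open Graph G

  module C (S : Subset ∣E∣) = Cuts (tail G (lookup S)) (head G (lookup S))

  -- The smallest t/s that the cut `X` permits. A set that no edge leaves would need an empty cut,
  -- which is the business of `Strong`; the value 2 is then neutral, because `index` is a maximum
  -- with 2 anyway.
  ratio : Subset ∣E∣ → Subset ∣V∣ → ℚ
  ratio S X with C.outSize S X
  ... | zero  = 2ℚ
  ... | suc k = (+ C.cutSize S X) / suc k

  -- The least t/s ≥ 2 for which the orientation S carries a circular t/s-flow,
  -- provided that S is strong.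
  index : Subset ∣E∣ → ℚ
  index S = max 2ℚ (List.map (ratio S) (allSubsets ∣V∣))

  Strong : Subset ∣E∣ → Set
  Strong S = ∀ X → C.outSize S X ≡ 0 → C.cutSize S X ≡ 0

  strong? : ∀ S → Dec (Strong S)
  strong? S with anySubset? (λ X → (C.outSize S X ℕ.≟ 0) ×-dec ¬? (C.cutSize S X ℕ.≟ 0))
  ... | yes (X , out≡0 , cut≢0) = no λ strong → cut≢0 (strong X out≡0)
  ... | no ¬bad = yes λ X out≡0 → decidable-stable (C.cutSize S X ℕ.≟ 0) λ cut≢0 → ¬bad (X , out≡0 , cut≢0)

  cutBound⇒strong : ∀ S t s → C.CutBound S t (suc s) → Strong S
  cutBound⇒strong S t s bound X out≡0 with bound X
  ... | le rewrite out≡0 | ℕ.*-zeroʳ t = ℕ.m+n≡0⇒m≡0 _ (ℕ.n≤0⇒n≡0 le)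

  cutBound⇒index≤ : ∀ S t s → 2 ℕ.* suc s ℕ.≤ t → C.CutBound S t (suc s) → index S ℚ.≤ (+ t) / suc s
  cutBound⇒index≤ S t s 2s≤t bound = max≤v⁺ 2≤ (All.map⁺ (All.universal ratio≤ (allSubsets ∣V∣)))
    where
    2≤ : 2ℚ ℚ.≤ (+ t) / suc s
    2≤ = /-mono-≤ 2 0 t s (ℕ.≤-trans 2s≤t (ℕ.≤-reflexive (sym (ℕ.*-identityʳ t))))
    ratio≤ : ∀ X → ratio S X ℚ.≤ (+ t) / suc s
    ratio≤ X with C.outSize S X in eq
    ... | zero  = 2≤
    ... | suc k = /-mono-≤ (C.cutSize S X) k t s
      (subst₂ ℕ._≤_ (ℕ.*-comm (suc s) (C.cutSize S X)) (cong (t ℕ.*_) eq) (bound X))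

  index≤⇒cutBound : ∀ S t s → Strong S → index S ℚ.≤ (+ t) / suc s → C.CutBound S t (suc s)
  index≤⇒cutBound S t s strong le X with ratio≤
    where
    ratio≤ : ratio S X ℚ.≤ (+ t) / suc s
    ratio≤ = ℚ.≤-trans (All.lookup (xs≤max 2ℚ (List.map (ratio S) (allSubsets ∣V∣)))
      (∈-map⁺ (ratio S) (∈-allSubsets X))) le
  ... | r≤ with C.outSize S X in eq
  ...   | zero rewrite strong X eq | ℕ.*-zeroʳ t | ℕ.*-zeroʳ s = ℕ.z≤n
  ...   | suc k = ℕ.≤-trans (ℕ.≤-reflexive (ℕ.*-comm (suc s) (C.cutSize S X)))
                            (/-cancel-≤ (C.cutSize S X) k t s r≤)

  div≡out-in : ∀ D f v → Hoffman.div (tail G D) (head G D) f v ≡ outflow G D f v - inflow G D f v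
  div≡out-in D f v = begin
    _ ≡⟨ sum-cong-≗ (λ e → split (f e) (does (tail G D e ≟ v)) (does (head G D e ≟ v))) ⟩
    _ ≡⟨ ∑-distrib-+ (λ e → if does (tail G D e ≟ v) then f e else 0ℤ)
                     (λ e → - (if does (head G D e ≟ v) then f e else 0ℤ)) ⟩
    _ ≡⟨ cong (ℤ._+_ (outflow G D f v)) (sum-neg (λ e → if does (head G D e ≟ v) then f e else 0ℤ)) ⟩
    _ ∎
    where
    open ≡-Reasoning
    split : ∀ x p q → x * ((if p then 1ℤ else 0ℤ) - (if q then 1ℤ else 0ℤ))
                    ≡ (if p then x else 0ℤ) + - (if q then x else 0ℤ)
    split x true  true  = trans (ℤ.*-zeroʳ x) (sym (ℤ.+-inverseʳ x))
    split x true  false = trans (ℤ.*-identityʳ x) (sym (ℤ.+-identityʳ x))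
    split x false true  = trans (trans (ℤ.*-comm x -1ℤ) (ℤ.-1*i≡-i x)) (sym (ℤ.+-identityˡ (- x)))
    split x false false = ℤ.*-zeroʳ x

  div≡0⇒balanced : ∀ D f v → Hoffman.div (tail G D) (head G D) f v ≡ 0ℤ → outflow G D f v ≡ inflow G D f v
  div≡0⇒balanced D f v eq = ℤ.i-j≡0⇒i≡j _ _ (trans (sym (div≡out-in D f v)) eq)

  cutBound⇒circularFlow : ∀ S t s → 2 ℕ.* suc s ℕ.≤ t → C.CutBound S t (suc s) → CircularFlow G t (suc s)
  cutBound⇒circularFlow S t s 2s≤t bound = from (C.cutBound⇒flow S (suc s) w (subst (λ t → C.CutBound S t (suc s)) t≡ bound))
    where
    w = t ℕ.∸ 2 ℕ.* suc s
    t≡ : t ≡ suc s ℕ.+ (suc s ℕ.+ w)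
    t≡ = trans (sym (ℕ.m+[n∸m]≡n 2s≤t)) (trans (cong (λ z → suc s ℕ.+ z ℕ.+ w) (ℕ.+-identityʳ (suc s)))
           (ℕ.+-assoc (suc s) (suc s) w))
    from : Hoffman.Feasible (tail G (lookup S)) (head G (lookup S)) (λ _ → + suc s) (λ _ → w) (λ _ → 0ℤ) →
           CircularFlow G t (suc s)
    from (f , bds , div≡0) = record
      { s>0 = ℕ.s≤s ℕ.z≤n
      ; 2s≤t = 2s≤t
      ; flow = record
        { D = lookup S
        ; f = f
        ; nowhereZero = λ e fe≡0 → case subst (suc s ℕ.≤_) (cong ∣_∣ fe≡0) (lo e) of λ ()
        ; bounded = λ e → ℕ.≤-<-trans (hi e) (ℕ.∸-monoʳ-< {t} (ℕ.s≤s ℕ.z≤n) (ℕ.≤-trans (ℕ.m≤m+n _ _) 2s≤t))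
        ; balanced = λ v → div≡0⇒balanced (lookup S) f v (div≡0 v)
        }
      ; lower = lo
      ; upper = hi
      }
      where
      nat : ∀ e → + ∣ f e ∣ ≡ f e
      nat e = ℤ.0≤i⇒+∣i∣≡i (ℤ.≤-trans (+≤+ ℕ.z≤n) (proj₁ (bds e)))
      lo : ∀ e → suc s ℕ.≤ ∣ f e ∣
      lo e = ℤ.drop‿+≤+ (subst (+ suc s ≤_) (sym (nat e)) (proj₁ (bds e)))
      hi : ∀ e → ∣ f e ∣ ℕ.≤ t ℕ.∸ suc s
      hi e = subst (∣ f e ∣ ℕ.≤_) (sym (trans (cong (ℕ._∸ suc s) t≡) (ℕ.m+n∸m≡n (suc s) (suc s ℕ.+ w))))
        (ℤ.drop‿+≤+ (subst (_≤ + (suc s ℕ.+ w)) (sym (nat e)) (proj₂ (bds e))))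

  -- Reversing the edges with negative values turns the flow into its absolute value, a circulation
  -- with values in [s, t - s].
  circularFlow⇒cutBound : ∀ t s → CircularFlow G t s → ∃ λ S → C.CutBound S t s
  circularFlow⇒cutBound t s F = S , C.flow⇒cutBound S t s (λ e → ∣ f e ∣) lower
    (λ e → ℕ.≤-trans (ℕ.+-monoʳ-≤ s (upper e)) (ℕ.≤-reflexive (ℕ.m+[n∸m]≡n s≤t))) div≡0
    where
    open CircularFlow F
    s≤t : s ℕ.≤ t
    s≤t = ℕ.≤-trans (ℕ.m≤m+n s _) 2s≤t
    reorient : ℤ → Bool → Bool
    reorient (+ _)    b = b
    reorient -[1+ _ ] b = not b
    S = tabulate λ e → reorient (f e) (D e)
    div≡0 : ∀ v → Hoffman.div (tail G (lookup S)) (head G (lookup S)) (λ e → + ∣ f e ∣) v ≡ 0ℤ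
    div≡0 v = trans (sum-cong-≗ pointwise) (trans (div≡out-in D f v) (ℤ.i≡j⇒i-j≡0 (balanced v)))
      where
      at : Vertex → ℤ
      at u = if does (u ≟ v) then 1ℤ else 0ℤ
      swap : ∀ x y z → x * (y - z) ≡ (- x) * (z - y)
      swap = solve-∀
      pointwise : ∀ e → + ∣ f e ∣ * ((if does (tail G (lookup S) e ≟ v) then 1ℤ else 0ℤ) -
                                     (if does (head G (lookup S) e ≟ v) then 1ℤ else 0ℤ))
                      ≡ f e * ((if does (tail G D e ≟ v) then 1ℤ else 0ℤ) -
                               (if does (head G D e ≟ v) then 1ℤ else 0ℤ))
      pointwise e rewrite lookup∘tabulate (λ e → reorient (f e) (D e)) e with f e | D e
      ... | + _      | _     = refl
      ... | -[1+ n ] | true  = swap (+ suc n) (at (proj₂ (ends e))) (at (proj₁ (ends e)))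
      ... | -[1+ n ] | false = swap (+ suc n) (at (proj₁ (ends e))) (at (proj₂ (ends e)))

  fromHasCircularFlow : ∀ q → HasCircularFlow G q → ∃ λ S → Strong S × index S ℚ.≤ q
  fromHasCircularFlow q record { t = t ; s = suc s ; r≡t/s = refl ; circularFlow = F } =
    let (S , bound) = circularFlow⇒cutBound t (suc s) F in
    S , cutBound⇒strong S t s bound , cutBound⇒index≤ S t s (CircularFlow.2s≤t F) bound

  -- The cut conditions still hold when t/s equals the maximum, so the bound is attained. The
  -- separate argument `r` can be matched as numerator and denominator without unfolding `index`.
  toHasCircularFlow : ∀ S r → Strong S → index S ≡ r → HasCircularFlow G r
  toHasCircularFlow S r@(mkℚ (+ t) s _) strong eq = record
    { t = t
    ; s = suc s
    ; r≡t/s = sym r≡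
    ; circularFlow = cutBound⇒circularFlow S t s 2s≤t (index≤⇒cutBound S t s strong (ℚ.≤-reflexive (trans eq (sym r≡))))
    }
    where
    r≡ : (+ t) / suc s ≡ r
    r≡ = ℚ.↥p/↧p≡p r
    2s≤t : 2 ℕ.* suc s ℕ.≤ t
    2s≤t = subst (2 ℕ.* suc s ℕ.≤_) (ℕ.*-identityʳ t) (/-cancel-≤ 2 0 t s
      (subst (2ℚ ℚ.≤_) (trans eq (sym r≡)) (⊥≤max 2ℚ (List.map (ratio S) (allSubsets ∣V∣)))))
  toHasCircularFlow S (mkℚ -[1+ _ ] _ _) strong eq
    with subst (2ℚ ℚ.≤_) eq (⊥≤max 2ℚ (List.map (ratio S) (allSubsets ∣V∣)))
  ... | ℚ.*≤* ()

  flowIndex-exists : ∀ q → HasCircularFlow G q → ∃ λ r → IsFlowIndex G r × r ℚ.≤ q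
  flowIndex-exists q has =
    index S* , (toHasCircularFlow S* _ S*-strong refl , minimal) , minimal q has
    where
    S₀ = proj₁ (fromHasCircularFlow q has)
    strongs = List.filter strong? (allSubsets ∣E∣)
    -- The orientation of the given flow is the starting candidate, so the minimum is never over an
    -- empty set.
    S* = argmin index S₀ strongs
    S*-strong : Strong S*
    S*-strong = argmin-all index {P = Strong} (proj₁ (proj₂ (fromHasCircularFlow q has)))
      (all-filter strong? (allSubsets ∣E∣))
    minimal : ∀ p → HasCircularFlow G p → index S* ℚ.≤ p
    minimal p has′ = let (S , strong , le) = fromHasCircularFlow p has′ in
      ℚ.≤-trans (All.lookup (f[argmin]≤f[xs] {f = index} S₀ strongs) (∈-filter⁺ strong? (∈-allSubsets S) strong)) le

-- The field with three elements

data 𝔽₃ : Set where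
  𝟎 𝟏 𝟐 : 𝔽₃

infixl 6 _⊕_ _⊖_
infixl 7 _⊗_
infix 8 ⊝_
infix 4 _≟₃_

_⊕_ _⊗_ _⊖_ : 𝔽₃ → 𝔽₃ → 𝔽₃
𝟎 ⊕ y = y
𝟏 ⊕ 𝟎 = 𝟏
𝟏 ⊕ 𝟏 = 𝟐
𝟏 ⊕ 𝟐 = 𝟎
𝟐 ⊕ 𝟎 = 𝟐
𝟐 ⊕ 𝟏 = 𝟎
𝟐 ⊕ 𝟐 = 𝟏

⊝_ : 𝔽₃ → 𝔽₃
⊝ 𝟎 = 𝟎
⊝ 𝟏 = 𝟐
⊝ 𝟐 = 𝟏

𝟎 ⊗ y = 𝟎
𝟏 ⊗ y = y
𝟐 ⊗ y = ⊝ y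

x ⊖ y = x ⊕ ⊝ y

_≟₃_ : (x y : 𝔽₃) → Dec (x ≡ y)
𝟎 ≟₃ 𝟎 = yes refl
𝟎 ≟₃ 𝟏 = no λ ()
𝟎 ≟₃ 𝟐 = no λ ()
𝟏 ≟₃ 𝟎 = no λ ()
𝟏 ≟₃ 𝟏 = yes refl
𝟏 ≟₃ 𝟐 = no λ ()
𝟐 ≟₃ 𝟎 = no λ ()
𝟐 ≟₃ 𝟏 = no λ ()
𝟐 ≟₃ 𝟐 = yes refl

-- Combined with `from-yes` this proves identities over `𝔽₃` by evaluating all cases, including
-- those special to characteristic 3.
∀₃? : {P : 𝔽₃ → Set} → Decidable P → Dec (∀ x → P x)
∀₃? P? = map′ (λ { (a , b , c) 𝟎 → a ; (a , b , c) 𝟏 → b ; (a , b , c) 𝟐 → c }) (λ f → f 𝟎 , f 𝟏 , f 𝟐)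
  (P? 𝟎 ×-dec P? 𝟏 ×-dec P? 𝟐)

⊕-assoc : ∀ x y z → (x ⊕ y) ⊕ z ≡ x ⊕ (y ⊕ z)
⊕-assoc = from-yes (∀₃? λ x → ∀₃? λ y → ∀₃? λ z → (x ⊕ y) ⊕ z ≟₃ x ⊕ (y ⊕ z))

⊕-comm : ∀ x y → x ⊕ y ≡ y ⊕ x
⊕-comm = from-yes (∀₃? λ x → ∀₃? λ y → x ⊕ y ≟₃ y ⊕ x)

⊕-identityʳ : ∀ x → x ⊕ 𝟎 ≡ x
⊕-identityʳ = from-yes (∀₃? λ x → x ⊕ 𝟎 ≟₃ x)

⊗-assoc : ∀ x y z → (x ⊗ y) ⊗ z ≡ x ⊗ (y ⊗ z)
⊗-assoc = from-yes (∀₃? λ x → ∀₃? λ y → ∀₃? λ z → (x ⊗ y) ⊗ z ≟₃ x ⊗ (y ⊗ z))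

⊗-comm : ∀ x y → x ⊗ y ≡ y ⊗ x
⊗-comm = from-yes (∀₃? λ x → ∀₃? λ y → x ⊗ y ≟₃ y ⊗ x)

⊗-distribˡ-⊕ : ∀ x y z → x ⊗ (y ⊕ z) ≡ (x ⊗ y) ⊕ (x ⊗ z)
⊗-distribˡ-⊕ = from-yes (∀₃? λ x → ∀₃? λ y → ∀₃? λ z → x ⊗ (y ⊕ z) ≟₃ (x ⊗ y) ⊕ (x ⊗ z))

⊗-distribʳ-⊕ : ∀ x y z → (y ⊕ z) ⊗ x ≡ (y ⊗ x) ⊕ (z ⊗ x)
⊗-distribʳ-⊕ = from-yes (∀₃? λ x → ∀₃? λ y → ∀₃? λ z → (y ⊕ z) ⊗ x ≟₃ (y ⊗ x) ⊕ (z ⊗ x))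

⊗-zeroʳ : ∀ x → x ⊗ 𝟎 ≡ 𝟎
⊗-zeroʳ = from-yes (∀₃? λ x → x ⊗ 𝟎 ≟₃ 𝟎)

⊗-identityʳ : ∀ x → x ⊗ 𝟏 ≡ x
⊗-identityʳ = from-yes (∀₃? λ x → x ⊗ 𝟏 ≟₃ x)

𝔽₃-commutativeSemiring : CommutativeSemiring 0ℓ 0ℓ
𝔽₃-commutativeSemiring = record
  { Carrier = 𝔽₃ ; _≈_ = _≡_ ; _+_ = _⊕_ ; _*_ = _⊗_ ; 0# = 𝟎 ; 1# = 𝟏
  ; isCommutativeSemiring = record
    { isSemiring = record
      { isSemiringWithoutAnnihilatingZero = record
        { +-isCommutativeMonoid = record
          { isMonoid = record
            { isSemigroup = record
              { isMagma = record { isEquivalence = isEquivalence ; ∙-cong = cong₂ _⊕_ }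
              ; assoc = ⊕-assoc }
            ; identity = (λ _ → refl) , ⊕-identityʳ }
          ; comm = ⊕-comm }
        ; *-cong = cong₂ _⊗_
        ; *-assoc = ⊗-assoc
        ; *-identity = (λ _ → refl) , ⊗-identityʳ
        ; distrib = ⊗-distribˡ-⊕ , ⊗-distribʳ-⊕ }
      ; zero = (λ _ → refl) , ⊗-zeroʳ }
    ; *-comm = ⊗-comm } }

open import Algebra.Properties.Semiring.Sum (CommutativeSemiring.semiring 𝔽₃-commutativeSemiring) as 𝔽Σ
  using () renaming (sum to Σ₃)

Σ₃-single : ∀ {n} (i : Fin n) (f : Fin n → 𝔽₃) → (∀ j → j ≢ i → f j ≡ 𝟎) → Σ₃ f ≡ f i
Σ₃-single {suc n} zero f f≡𝟎 = trans
  (cong (f zero ⊕_) (trans (𝔽Σ.sum-cong-≗ (λ j → f≡𝟎 (suc j) λ ())) (𝔽Σ.sum-replicate-zero n)))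
  (⊕-identityʳ (f zero))
Σ₃-single (suc i) f f≡𝟎 = trans (cong (_⊕ Σ₃ (f ∘ suc)) (f≡𝟎 zero λ ()))
  (Σ₃-single i (f ∘ suc) λ j j≢i → f≡𝟎 (suc j) λ { refl → j≢i refl })

lift : 𝔽₃ → ℤ
lift 𝟎 = 0ℤ
lift 𝟏 = 1ℤ
lift 𝟐 = -1ℤ

lift-⊕ : ∀ x y → ∃ λ c → lift x ℤ.+ lift y ≡ lift (x ⊕ y) ℤ.+ + 3 ℤ.* c
lift-⊕ 𝟎 𝟎 = 0ℤ , refl
lift-⊕ 𝟎 𝟏 = 0ℤ , refl
lift-⊕ 𝟎 𝟐 = 0ℤ , refl
lift-⊕ 𝟏 𝟎 = 0ℤ , refl
lift-⊕ 𝟏 𝟏 = 1ℤ , refl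
lift-⊕ 𝟏 𝟐 = 0ℤ , refl
lift-⊕ 𝟐 𝟎 = 0ℤ , refl
lift-⊕ 𝟐 𝟏 = 0ℤ , refl
lift-⊕ 𝟐 𝟐 = -1ℤ , refl

lift-Σ : ∀ {n} (f : Fin n → 𝔽₃) → ∃ λ c → sum (λ i → lift (f i)) ≡ lift (Σ₃ f) ℤ.+ + 3 ℤ.* c
lift-Σ {zero}  f = 0ℤ , refl
lift-Σ {suc n} f with lift-Σ (f ∘ suc) | lift-⊕ (f zero) (Σ₃ (f ∘ suc))
... | c , eq | d , eq′ = d ℤ.+ c , (begin
  lift (f zero) ℤ.+ sum (λ i → lift (f (suc i)))             ≡⟨ cong (ℤ._+_ (lift (f zero))) eq ⟩
  lift (f zero) ℤ.+ (lift (Σ₃ (f ∘ suc)) ℤ.+ + 3 ℤ.* c)       ≡⟨ ℤ.+-assoc (lift (f zero)) _ _ ⟨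
  lift (f zero) ℤ.+ lift (Σ₃ (f ∘ suc)) ℤ.+ + 3 ℤ.* c         ≡⟨ cong (ℤ._+ (+ 3 ℤ.* c)) eq′ ⟩
  lift (Σ₃ f) ℤ.+ + 3 ℤ.* d ℤ.+ + 3 ℤ.* c                     ≡⟨ ring (lift (Σ₃ f)) d c ⟩
  lift (Σ₃ f) ℤ.+ + 3 ℤ.* (d ℤ.+ c)                           ∎)
  where
  open ≡-Reasoning
  ring : ∀ x d c → x ℤ.+ + 3 ℤ.* d ℤ.+ + 3 ℤ.* c ≡ x ℤ.+ + 3 ℤ.* (d ℤ.+ c)
  ring = solve-∀

-- From modular flows to circular flows

sumℕ≡0 : ∀ {n} (f : Fin n → ℕ) → ℕΣ.sum f ≡ 0 → ∀ i → f i ≡ 0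
sumℕ≡0 f eq zero    = ℕ.m+n≡0⇒m≡0 (f zero) eq
sumℕ≡0 f eq (suc i) = sumℕ≡0 (f ∘ suc) (ℕ.m+n≡0⇒n≡0 (f zero) eq) i

sumℕ-≤1 : ∀ {n} (f : Fin n → ℕ) → (∀ i → f i ℕ.≤ 1) → ℕΣ.sum f ℕ.≤ n
sumℕ-≤1 {zero}  f f≤1 = ℕ.z≤n
sumℕ-≤1 {suc n} f f≤1 = ℕ.+-mono-≤ (f≤1 zero) (sumℕ-≤1 (f ∘ suc) (f≤1 ∘ suc))

module ModularFlow (G : Graph) where
  open Graph G

  δ : Vertex → Vertex → 𝔽₃
  δ u v = if does (u ≟ v) then 𝟏 else 𝟎

  inc : Edge → Vertex → 𝔽₃
  inc e v = δ (proj₁ (ends e)) v ⊖ δ (proj₂ (ends e)) v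

  ∂ : (Edge → 𝔽₃) → Vertex → 𝔽₃
  ∂ x v = Σ₃ λ e → x e ⊗ inc e v

  sgn : ∀ {e u v} → Joins e u v → 𝔽₃
  sgn (inj₁ _) = 𝟏
  sgn (inj₂ _) = 𝟐

  -- A nonzero value orients its edge: along `ends` for 𝟏, against it for 𝟐.
  Arc : (Edge → 𝔽₃) → Vertex → Vertex → Set
  Arc x u v = ∃ λ e → ∃ λ (j : Joins e u v) → x e ≡ sgn j

  module Lifting (x : Edge → 𝔽₃) (x≢𝟎 : ∀ e → x e ≢ 𝟎) (∂x≡𝟎 : ∀ v → ∂ x v ≡ 𝟎)
                 (connected : ∀ u v → Star (Arc x) u v) where

    along : 𝔽₃ → Bool
    along 𝟏 = true
    along _ = false

    S : Subset ∣E∣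
    S = tabulate λ e → along (x e)

    tl hd : Edge → Vertex
    tl = tail G (lookup S)
    hd = head G (lookup S)

    open Hoffman tl hd
    open Cuts tl hd

    closed : ∀ X → outSize X ≡ 0 → ∀ {u v} → Arc x u v → lookup X u ≡ true → lookup X v ≡ true
    closed X out≡0 {u} {v} (e , j , xe≡) Xu with sumℕ≡0 (outs X) out≡0 e
    ... | leaves≡0 rewrite lookup∘tabulate (λ e → along (x e)) e with j | x e
    ... | inj₁ refl | 𝟏 rewrite Xu with lookup X v
    ...   | true = refl
    closed X out≡0 {u} {v} (e , j , refl) Xu | leaves≡0 | inj₂ refl | 𝟐 rewrite Xu with lookup X v
    ...   | true = refl

    closed* : ∀ X → outSize X ≡ 0 → ∀ {u v} → Star (Arc x) u v → lookup X u ≡ true → lookup X v ≡ true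
    closed* X out≡0 ε        Xu = Xu
    closed* X out≡0 (a ◅ as) Xu = closed* X out≡0 as (closed X out≡0 a Xu)

    -- A set that no edge leaves is closed under arcs. Since any two vertices reach each other, the
    -- two ends of an edge lie on the same side.
    strong : FlowIndex.Strong G S
    strong X out≡0 = trans (ℕΣ.sum-cong-≗ λ e → crosses≡0 (connected (tl e) (hd e)) (connected (hd e) (tl e)))
                           (ℕΣ.sum-replicate-zero ∣E∣)
      where
      crosses≡0 : ∀ {u v} → Star (Arc x) u v → Star (Arc x) v u → crosses (lookup X u) (lookup X v) ≡ 0
      crosses≡0 {u} {v} uv vu with lookup X u | lookup X v | closed* X out≡0 uv | closed* X out≡0 vu
      ... | true  | true  | _ | _ = refl
      ... | false | false | _ | _ = refl
      ... | true  | false | f | _ = case f refl of λ ()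
      ... | false | true  | _ | g = case g refl of λ ()

    -- As soon as one edge leaves `X`, the cut bound is trivial for the ratio |E| + 2, because at
    -- most |E| edges cross; if none leaves, strength empties the cut.
    positive : Feasible (λ _ → + 1) (λ _ → ∣E∣) (λ _ → 0ℤ)
    positive = cutBound⇒flow 1 ∣E∣ bound
      where
      crosses≤1 : ∀ p q → crosses p q ℕ.≤ 1
      crosses≤1 true  true  = ℕ.z≤n
      crosses≤1 true  false = ℕ.≤-refl
      crosses≤1 false true  = ℕ.≤-refl
      crosses≤1 false false = ℕ.z≤n
      bound : CutBound (1 ℕ.+ (1 ℕ.+ ∣E∣)) 1
      bound X with outSize X in eq
      ... | zero  rewrite strong X eq = ℕ.z≤n
      ... | suc k = begin
        1 ℕ.* cutSize X                    ≡⟨ ℕ.*-identityˡ _ ⟩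
        cutSize X                          ≤⟨ sumℕ-≤1 (cuts X) (λ e → crosses≤1 (lookup X (tl e)) (lookup X (hd e))) ⟩
        ∣E∣                                ≤⟨ ℕ.m≤n+m ∣E∣ 2 ⟩
        2 ℕ.+ ∣E∣                          ≤⟨ ℕ.m≤m*n (2 ℕ.+ ∣E∣) (suc k) ⟩
        (2 ℕ.+ ∣E∣) ℕ.* suc k              ∎
        where open ℕ.≤-Reasoning

    -- `S` reverses the edges of value `𝟐`, which is -1, so after reorientation the ℤ/3-flow is the
    -- constant 1 and its integral divergence is divisible by 3.
    unit-div : ∀ v → ∃ λ p → div (λ _ → 1ℤ) v ≡ + 3 * p
    unit-div v = let (p , eq) = lift-Σ (λ e → x e ⊗ inc e v) in
      p , trans (sum-cong-≗ pointwise) (trans eq (trans (cong (λ z → lift z + + 3 * p) (∂x≡𝟎 v)) (ℤ.+-identityˡ _)))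
      where
      plus : ∀ p q → 1ℤ * ((if p then 1ℤ else 0ℤ) - (if q then 1ℤ else 0ℤ)) ≡
                     lift ((if p then 𝟏 else 𝟎) ⊖ (if q then 𝟏 else 𝟎))
      plus true  true  = refl
      plus true  false = refl
      plus false true  = refl
      plus false false = refl
      minus : ∀ p q → 1ℤ * ((if q then 1ℤ else 0ℤ) - (if p then 1ℤ else 0ℤ)) ≡
                      lift (⊝ ((if p then 𝟏 else 𝟎) ⊖ (if q then 𝟏 else 𝟎)))
      minus true  true  = refl
      minus true  false = refl
      minus false true  = refl
      minus false false = refl
      pointwise : ∀ e → 1ℤ * ((if does (tl e ≟ v) then 1ℤ else 0ℤ) - (if does (hd e ≟ v) then 1ℤ else 0ℤ))
                      ≡ lift (x e ⊗ inc e v)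
      pointwise e rewrite lookup∘tabulate (λ e → along (x e)) e with x e in xe≡
      ... | 𝟎 = contradiction xe≡ (x≢𝟎 e)
      ... | 𝟏 = plus (does (proj₁ (ends e) ≟ v)) _
      ... | 𝟐 = minus (does (proj₁ (ends e) ≟ v)) _

    p : Vertex → ℤ
    p v = proj₁ (unit-div v)

    3p≡ : ∀ X → + 3 * demand p X ≡ cutCap (λ _ → 1ℤ) (λ _ → 1ℤ) X
    3p≡ X = trans (*-distribˡ-sum (+ 3) (λ v → dem (p v) (lookup X v)))
      (trans (sum-cong-≗ λ v → pointwise (lookup X v) (proj₂ (unit-div v))) (demand-div (λ _ → 1ℤ) X))
      where
      pointwise : ∀ {b c} r → c ≡ + 3 * b → + 3 * dem b r ≡ dem c r
      pointwise true  refl = refl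
      pointwise false refl = refl

    ∑p≡0 : sum p ≡ 0ℤ
    ∑p≡0 = ℤ.*-cancelˡ-≡ (+ 3) (sum p) 0ℤ (trans (cong (+ 3 *_) ∑p≡) (trans (3p≡ whole) (sum-zero full-cap)))
      where
      whole = tabulate λ _ → true
      ∑p≡ : sum p ≡ demand p whole
      ∑p≡ = sum-cong-≗ λ v → cong (dem (p v)) (sym (lookup∘tabulate (λ _ → true) v))
      full-cap : ∀ e → cap 1ℤ 1ℤ (lookup whole (tl e)) (lookup whole (hd e)) ≡ 0ℤ
      full-cap e rewrite lookup∘tabulate (λ _ → true) (tl e) | lookup∘tabulate (λ _ → true) (hd e) = refl

    -- Tutte's lifting: 3y is subtracted from the all-ones mod 3 flow.
    correction : Feasible (λ _ → 0ℤ) (λ _ → 1) p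
    -- Multiplied by 3, the cut condition reads out - in ≤ 3 · out.
    correction = hoffman _ _ _ ∑p≡0 λ X → ℤ.*-cancelˡ-≤-pos _ _ (+ 3)
      (subst₂ _≤_ (sym (3p≡ X)) (sym (*-distribˡ-sum (+ 3) (λ e → cap 1ℤ 0ℤ (lookup X (tl e)) (lookup X (hd e)))))
        (sum-mono-≤ λ e → pointwise (lookup X (tl e)) (lookup X (hd e))))
      where
      pointwise : ∀ p q → cap 1ℤ 1ℤ p q ≤ + 3 * cap 1ℤ 0ℤ p q
      pointwise true  true  = ℤ.≤-refl
      pointwise true  false = +≤+ (ℕ.s≤s ℕ.z≤n)
      pointwise false true  = ℤ.-≤+
      pointwise false false = ℤ.≤-refl

    -- With 1 ≤ g ≤ |E| + 1 the values k + g and -2k + g must have absolute values in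
    -- [k + 1, 2k - 1]. The tight requirement is g ≤ k - 1, which gives this constant.
    k : ℕ
    k = 2 ℕ.+ ∣E∣

    y g f : Edge → ℤ
    y = proj₁ correction
    g = proj₁ positive
    f e = + k * (1ℤ - + 3 * y e) + g e

    f-balanced : ∀ v → div f v ≡ 0ℤ
    f-balanced v = begin
      div f v
        ≡⟨ sum-cong-≗ (λ e → expand (+ k) (y e) (g e) (at e)) ⟩
      sum (λ e → + k * (1ℤ * at e) + - (+ 3 * + k) * (y e * at e) + g e * at e)
        ≡⟨ ∑-distrib-+ (λ e → + k * (1ℤ * at e) + - (+ 3 * + k) * (y e * at e)) (λ e → g e * at e) ⟩
      sum (λ e → + k * (1ℤ * at e) + - (+ 3 * + k) * (y e * at e)) + div g v
        ≡⟨ cong₂ _+_ (∑-distrib-+ (λ e → + k * (1ℤ * at e)) (λ e → - (+ 3 * + k) * (y e * at e)))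
                     (proj₂ (proj₂ positive) v) ⟩
      sum (λ e → + k * (1ℤ * at e)) + sum (λ e → - (+ 3 * + k) * (y e * at e)) + 0ℤ
        ≡⟨ cong (_+ 0ℤ) (cong₂ _+_ (sym (*-distribˡ-sum (+ k) (λ e → 1ℤ * at e)))
                                     (sym (*-distribˡ-sum (- (+ 3 * + k)) (λ e → y e * at e)))) ⟩
      + k * div (λ _ → 1ℤ) v + - (+ 3 * + k) * div y v + 0ℤ
        ≡⟨ cong₂ (λ a b → + k * a + - (+ 3 * + k) * b + 0ℤ) (proj₂ (unit-div v)) (proj₂ (proj₂ correction) v) ⟩
      + k * (+ 3 * p v) + - (+ 3 * + k) * p v + 0ℤ
        ≡⟨ cancel (+ k) (p v) ⟩
      0ℤ ∎
      where
      open ≡-Reasoning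
      at : Edge → ℤ
      at e = (if does (tl e ≟ v) then 1ℤ else 0ℤ) - (if does (hd e ≟ v) then 1ℤ else 0ℤ)
      expand : ∀ k y g a → (k * (1ℤ - + 3 * y) + g) * a ≡ k * (1ℤ * a) + - (+ 3 * k) * (y * a) + g * a
      expand = solve-∀
      cancel : ∀ k p → k * (+ 3 * p) + - (+ 3 * k) * p + 0ℤ ≡ 0ℤ
      cancel = solve-∀

    f-range : ∀ e → suc k ℕ.≤ ∣ f e ∣ × ∣ f e ∣ ℕ.≤ 3 ℕ.* k ℕ.∸ suc k
    f-range e = range (y e) (g e) (proj₁ (proj₂ correction) e) (proj₁ (proj₂ positive) e)
      where
      hi≡ : 3 ℕ.* k ℕ.∸ suc k ≡ k ℕ.+ (1 ℕ.+ ∣E∣)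
      hi≡ = trans (cong (ℕ._∸ suc k) (eq ∣E∣)) (ℕ.m+n∸m≡n (suc k) _)
        where
        eq : ∀ m → 3 ℕ.* (2 ℕ.+ m) ≡ suc (2 ℕ.+ m) ℕ.+ (2 ℕ.+ m ℕ.+ (1 ℕ.+ m))
        eq = ℕ-solve-∀
      range : ∀ y g → 0ℤ ≤ y × y ≤ + 1 → + 1 ≤ g × g ≤ + 1 + + ∣E∣ →
              let a = ∣ + k * (1ℤ - + 3 * y) + g ∣ in suc k ℕ.≤ a × a ℕ.≤ 3 ℕ.* k ℕ.∸ suc k
      range (+ 0) (+ g) _ (+≤+ 1≤g , +≤+ g≤) rewrite hi≡ | ℕ.*-identityʳ ∣E∣ =
        subst (ℕ._≤ k ℕ.+ g) (ℕ.+-comm k 1) (ℕ.+-monoʳ-≤ k 1≤g) , ℕ.+-monoʳ-≤ k g≤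
      range (+ 1) (+ g) _ (+≤+ 1≤g , +≤+ g≤) rewrite hi≡ =
        subst (λ a → suc k ℕ.≤ a × a ℕ.≤ k ℕ.+ (1 ℕ.+ ∣E∣)) (sym value)
          (subst (suc k ℕ.≤_) (sym (ℕ.+-suc k h)) (ℕ.s≤s (ℕ.m≤m+n k h)) , ℕ.+-monoʳ-≤ k (ℕ.s≤s h≤))
        where
        -- The slack k - 1 - g, so that 2k - g = k + 1 + h.
        h = 1 ℕ.+ ∣E∣ ℕ.∸ g
        h≤ : h ℕ.≤ ∣E∣
        h≤ = ℕ.∸-monoʳ-≤ (1 ℕ.+ ∣E∣) 1≤g
        eq : ∀ g h → (1ℤ + (g + h)) * (1ℤ - + 3 * 1ℤ) + g ≡ - (1ℤ + (g + h) + (1ℤ + h))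
        eq = solve-∀
        k≡ : k ≡ 1 ℕ.+ (g ℕ.+ h)
        k≡ = cong suc (sym (ℕ.m+[n∸m]≡n g≤))
        value : ∣ + k * (1ℤ - + 3 * 1ℤ) + + g ∣ ≡ k ℕ.+ (1 ℕ.+ h)
        value = begin
          ∣ + k * (1ℤ - + 3 * 1ℤ) + + g ∣                    ≡⟨ cong (λ z → ∣ + z * (1ℤ - + 3 * 1ℤ) + + g ∣) k≡ ⟩
          ∣ (1ℤ + (+ g + + h)) * (1ℤ - + 3 * 1ℤ) + + g ∣     ≡⟨ cong ∣_∣ (eq (+ g) (+ h)) ⟩
          ∣ - (1ℤ + (+ g + + h) + (1ℤ + + h)) ∣             ≡⟨ ℤ.∣-i∣≡∣i∣ (1ℤ + (+ g + + h) + (1ℤ + + h)) ⟩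
          1 ℕ.+ (g ℕ.+ h) ℕ.+ (1 ℕ.+ h)                      ≡⟨ cong (ℕ._+ (1 ℕ.+ h)) (sym k≡) ⟩
          k ℕ.+ (1 ℕ.+ h)                                    ∎
          where open ≡-Reasoning
      range (+ suc (suc _)) _ (_ , +≤+ (ℕ.s≤s ())) _

    circularFlow : CircularFlow G (3 ℕ.* k) (suc k)
    circularFlow = record
      { s>0 = ℕ.s≤s ℕ.z≤n
      ; 2s≤t = 2s≤t
      ; flow = record
        { D = lookup S
        ; f = f
        ; nowhereZero = λ e fe≡0 → case subst (suc k ℕ.≤_) (cong ∣_∣ fe≡0) (proj₁ (f-range e)) of λ ()
        ; bounded = λ e → ℕ.≤-<-trans (proj₂ (f-range e))
            (ℕ.∸-monoʳ-< {3 ℕ.* k} {suc k} {0} (ℕ.s≤s ℕ.z≤n) (ℕ.≤-trans (ℕ.m≤m+n (suc k) _) 2s≤t))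
        ; balanced = λ v → FlowIndex.div≡0⇒balanced G (lookup S) f v (f-balanced v)
        }
      ; lower = proj₁ ∘ f-range
      ; upper = proj₂ ∘ f-range
      }
      where
      eq : ∀ m → 3 ℕ.* (2 ℕ.+ m) ≡ 2 ℕ.* suc (2 ℕ.+ m) ℕ.+ m
      eq = ℕ-solve-∀
      2s≤t : 2 ℕ.* suc k ℕ.≤ 3 ℕ.* k
      2s≤t = ℕ.≤-trans (ℕ.m≤m+n _ ∣E∣) (ℕ.≤-reflexive (sym (eq ∣E∣)))

    flowIndex<3 : ∃ λ r → IsFlowIndex G r × r ℚ.< (+ 3) / 1
    flowIndex<3 = let (r , isIndex , r≤) = FlowIndex.flowIndex-exists G ((+ (3 ℕ.* k)) / suc k) record
                        { t = 3 ℕ.* k ; s = suc k ; r≡t/s = refl ; circularFlow = circularFlow } in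
      r , isIndex , ℚ.≤-<-trans r≤ (/-mono-< (3 ℕ.* k) k 3 0
        (subst (ℕ._< 3 ℕ.* suc k) (sym (ℕ.*-identityʳ (3 ℕ.* k))) (ℕ.*-monoʳ-< 3 (ℕ.n<1+n k))))

-- Triangle-trees

nonzero : 𝔽₃ → ℕ
nonzero 𝟎 = 0
nonzero _ = 1

∪-inj : ∀ {n} {x : Fin n} {p q} → x ∈ p ∪ q → x ∈ p ⊎ x ∈ q
∪-inj = x∈p∪q⁻ _ _

module Trees (G : Graph) where
  open Graph G
  open ModularFlow G

  δ-refl : ∀ v → δ v v ≡ 𝟏
  δ-refl v with v ≟ v
  ... | yes _  = refl
  ... | no v≢v = contradiction refl v≢v

  δ-≢ : ∀ {u v} → u ≢ v → δ u v ≡ 𝟎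
  δ-≢ {u} {v} u≢v with u ≟ v
  ... | yes u≡v = contradiction u≡v u≢v
  ... | no _    = refl

  joins-≢ : ∀ {e u v} → Joins e u v → u ≢ v
  joins-≢ {e} (inj₁ eq) refl = loopless e (trans (cong proj₁ eq) (sym (cong proj₂ eq)))
  joins-≢ {e} (inj₂ eq) refl = loopless e (trans (cong proj₁ eq) (sym (cong proj₂ eq)))

  joins-sym : ∀ {e u v} → Joins e u v → Joins e v u
  joins-sym (inj₁ eq) = inj₂ eq
  joins-sym (inj₂ eq) = inj₁ eq

  joins-unique : ∀ {e u v u′ v′} → Joins e u v → Joins e u′ v′ → (u ≡ u′ × v ≡ v′) ⊎ (u ≡ v′ × v ≡ u′)
  joins-unique (inj₁ p) (inj₁ q) with refl ← trans (sym p) q = inj₁ (refl , refl)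
  joins-unique (inj₁ p) (inj₂ q) with refl ← trans (sym p) q = inj₂ (refl , refl)
  joins-unique (inj₂ p) (inj₁ q) with refl ← trans (sym p) q = inj₂ (refl , refl)
  joins-unique (inj₂ p) (inj₂ q) with refl ← trans (sym p) q = inj₁ (refl , refl)

  pair : Vertex × Vertex → Vertex → 𝔽₃
  pair (u , v) w = δ u w ⊖ δ v w

  sgn-inc : ∀ {e u v} (j : Joins e u v) w → sgn j ⊗ inc e w ≡ pair (u , v) w
  sgn-inc (inj₁ eq) w rewrite eq = refl
  sgn-inc {u = u} {v} (inj₂ eq) w rewrite eq = swap (δ v w) (δ u w)
    where
    swap : ∀ a b → ⊝ (a ⊖ b) ≡ b ⊖ a
    swap = from-yes (∀₃? λ a → ∀₃? λ b → ⊝ (a ⊖ b) ≟₃ b ⊖ a)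

  sgn≢𝟎 : ∀ {e u v} (j : Joins e u v) → sgn j ≢ 𝟎
  sgn≢𝟎 (inj₁ _) ()
  sgn≢𝟎 (inj₂ _) ()

  infixl 6 _⊞_
  _⊞_ : (Edge → 𝔽₃) → (Edge → 𝔽₃) → Edge → 𝔽₃
  (x ⊞ y) e = x e ⊕ y e

  ∂-⊞ : ∀ x y v → ∂ (x ⊞ y) v ≡ ∂ x v ⊕ ∂ y v
  ∂-⊞ x y v = trans (𝔽Σ.sum-cong-≗ λ e → ⊗-distribʳ-⊕ (inc e v) (x e) (y e))
                    (𝔽Σ.∑-distrib-+ (λ e → x e ⊗ inc e v) (λ e → y e ⊗ inc e v))

  ∂-scale : ∀ c x v → ∂ (λ e → c ⊗ x e) v ≡ c ⊗ ∂ x v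
  ∂-scale c x v = trans (𝔽Σ.sum-cong-≗ λ e → ⊗-assoc c (x e) (inc e v))
                        (sym (𝔽Σ.*-distribˡ-sum c (λ e → x e ⊗ inc e v)))

  -- The amount `s` sent from `u` to `v` along `e`; the factor `sgn j` makes this independent of the
  -- order in `ends`.
  arc : ∀ {e u v} → Joins e u v → 𝔽₃ → Edge → 𝔽₃
  arc {e} j s e′ = if does (e ≟ e′) then s ⊗ sgn j else 𝟎

  arc-at : ∀ {e u v} (j : Joins e u v) s → arc j s e ≡ s ⊗ sgn j
  arc-at {e} j s with e ≟ e
  ... | yes _  = refl
  ... | no e≢e = contradiction refl e≢e

  arc-off : ∀ {e u v} (j : Joins e u v) s {e′} → e ≢ e′ → arc j s e′ ≡ 𝟎
  arc-off {e} j s {e′} e≢e′ with e ≟ e′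
  ... | yes e≡e′ = contradiction e≡e′ e≢e′
  ... | no _     = refl

  ∂-arc : ∀ {e u v} (j : Joins e u v) s w → ∂ (arc j s) w ≡ s ⊗ pair (u , v) w
  ∂-arc {e} {u} {v} j s w = begin
    ∂ (arc j s) w                ≡⟨ Σ₃-single e _ (λ e′ e′≢e → cong (_⊗ inc e′ w) (arc-off j s (e′≢e ∘ sym))) ⟩
    arc j s e ⊗ inc e w          ≡⟨ cong (_⊗ inc e w) (arc-at j s) ⟩
    s ⊗ sgn j ⊗ inc e w          ≡⟨ ⊗-assoc s (sgn j) (inc e w) ⟩
    s ⊗ (sgn j ⊗ inc e w)        ≡⟨ cong (s ⊗_) (sgn-inc j w) ⟩
    s ⊗ pair (u , v) w           ∎
    where open ≡-Reasoning

  ⊗-nonzero : ∀ {s t} → s ≢ 𝟎 → t ≢ 𝟎 → s ⊗ t ≢ 𝟎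
  ⊗-nonzero {𝟎}     s≢𝟎 _   _ = s≢𝟎 refl
  ⊗-nonzero {𝟏}     _   t≢𝟎 = t≢𝟎
  ⊗-nonzero {𝟐} {𝟎} _   t≢𝟎 _ = t≢𝟎 refl
  ⊗-nonzero {𝟐} {𝟏} _   _ ()
  ⊗-nonzero {𝟐} {𝟐} _   _ ()

  record Carries (E : Subset ∣E∣) (x : Edge → 𝔽₃) : Set where
    field
      on  : ∀ {e} → e ∈ E → x e ≢ 𝟎
      off : ∀ {e} → e ∉ E → x e ≡ 𝟎
  open Carries

  carries-arc : ∀ {e u v} (j : Joins e u v) {s} → s ≢ 𝟎 → Carries ⁅ e ⁆ (arc j s)
  carries-arc {e} j {s} s≢𝟎 .on e′∈ with refl ← x∈⁅y⁆⇒x≡y e e′∈ =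
    subst (_≢ 𝟎) (sym (arc-at j s)) (⊗-nonzero s≢𝟎 (sgn≢𝟎 j))
  carries-arc j {s} s≢𝟎 .off e′∉ = arc-off j s λ { refl → e′∉ (x∈⁅x⁆ _) }

  carries-⊞ : ∀ {E E′ x y} → Carries E x → Carries E′ y → (∀ {e} → e ∈ E → e ∉ E′) → Carries (E ∪ E′) (x ⊞ y)
  carries-⊞ {x = x} {y} cx cy disjoint .on {e} e∈ with ∪-inj e∈
  ... | inj₁ e∈E  rewrite off cy (disjoint e∈E) | ⊕-identityʳ (x e) = on cx e∈E
  ... | inj₂ e∈E′ rewrite off cx (λ e∈E → disjoint e∈E e∈E′) = on cy e∈E′
  carries-⊞ cx cy disjoint .off e∉
    rewrite off cx (e∉ ∘ x∈p∪q⁺ ∘ inj₁) | off cy (e∉ ∘ x∈p∪q⁺ ∘ inj₂) = refl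

  carries-scale : ∀ {E x c} → c ≢ 𝟎 → Carries E x → Carries E (λ e → c ⊗ x e)
  carries-scale c≢𝟎 cx .on e∈E = ⊗-nonzero c≢𝟎 (on cx e∈E)
  carries-scale {c = c} c≢𝟎 cx .off e∉E = trans (cong (c ⊗_) (off cx e∉E)) (⊗-zeroʳ c)

  -- A triangle-tree as an edge with k ears of length two, each on an edge
  -- already present.
  data TwoTree : ℕ → Subset ∣V∣ → Subset ∣E∣ → Set where
    base   : ∀ {e y z} → Joins e y z → TwoTree 0 (⁅ y ⁆ ∪ ⁅ z ⁆) ⁅ e ⁆
    extend : ∀ {k V E x y z e a b} → TwoTree k V E → e ∈ E → Joins e y z → x ∉ V →
             Joins a x y → Joins b x z → TwoTree (suc k) (V ∪ ⁅ x ⁆) (E ∪ ⁅ a ⁆ ∪ ⁅ b ⁆)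

  private variable
    k ℓ m : ℕ
    V : Subset ∣V∣
    E : Subset ∣E∣

  fromTriangleTree : TriangleTree G V E → ∃ λ m → TwoTree (suc m) V E
  fromTriangleTree (triangle {x₁} {x₂} {x₃} {e₁₂} j₁₂ j₁₃ j₂₃) =
    0 , subst (λ V → TwoTree 1 V _) (∪-assoc ⁅ x₁ ⁆ ⁅ x₂ ⁆ ⁅ x₃ ⁆)
          (extend (base j₁₂) (x∈⁅x⁆ e₁₂) j₁₂ x₃∉ (joins-sym j₁₃) (joins-sym j₂₃))
    where
    x₃∉ : x₃ ∉ ⁅ x₁ ⁆ ∪ ⁅ x₂ ⁆
    x₃∉ x₃∈ with ∪-inj x₃∈
    ... | inj₁ p = joins-≢ j₁₃ (sym (x∈⁅y⁆⇒x≡y _ p))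
    ... | inj₂ p = joins-≢ j₂₃ (sym (x∈⁅y⁆⇒x≡y _ p))
  fromTriangleTree (extend T e∈ je x∉ ja jb) =
    let (m , T′) = fromTriangleTree T in suc m , extend T′ e∈ je x∉ ja jb

  ∣∪⁅x⁆∣ : ∀ {n} {x : Fin n} (p : Subset n) → x ∉ p → card (p ∪ ⁅ x ⁆) ≡ suc (card p)
  ∣∪⁅x⁆∣ {x = zero}  (inside  ∷ p) x∉ = contradiction Vec.here x∉
  ∣∪⁅x⁆∣ {x = zero}  (outside ∷ p) x∉ = cong (suc ∘ card) (∪-identityʳ p)
  ∣∪⁅x⁆∣ {x = suc x} (inside  ∷ p) x∉ = cong suc (∣∪⁅x⁆∣ p (x∉ ∘ Vec.there))
  ∣∪⁅x⁆∣ {x = suc x} (outside ∷ p) x∉ = ∣∪⁅x⁆∣ p (x∉ ∘ Vec.there)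

  size : TwoTree k V E → card V ≡ suc (suc k)
  size (base {y = y} {z} j) = trans (∣∪⁅x⁆∣ ⁅ y ⁆ λ z∈ → joins-≢ j (sym (x∈⁅y⁆⇒x≡y y z∈))) (cong suc (∣⁅x⁆∣≡1 y))
  size (extend {V = V} T _ _ x∉ _ _) = trans (∣∪⁅x⁆∣ V x∉) (cong suc (size T))

  ends∈ : TwoTree k V E → ∀ {e u v} → e ∈ E → Joins e u v → u ∈ V × v ∈ V
  ends∈ (base {e} j) e′∈ j′ with refl ← x∈⁅y⁆⇒x≡y e e′∈ with joins-unique j j′
  ... | inj₁ (refl , refl) = x∈p∪q⁺ (inj₁ (x∈⁅x⁆ _)) , x∈p∪q⁺ (inj₂ (x∈⁅x⁆ _))
  ... | inj₂ (refl , refl) = x∈p∪q⁺ (inj₂ (x∈⁅x⁆ _)) , x∈p∪q⁺ (inj₁ (x∈⁅x⁆ _))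
  ends∈ (extend {V = V} {x = x} T e∈ je x∉ ja jb) e′∈ j′ with ends∈ T e∈ je | ∪-inj e′∈
  ... | y∈ , z∈ | inj₁ e′∈E = let (u∈ , v∈) = ends∈ T e′∈E j′ in x∈p∪q⁺ (inj₁ u∈) , x∈p∪q⁺ (inj₁ v∈)
  ... | y∈ , z∈ | inj₂ e′∈ab with ∪-inj e′∈ab
  ...   | inj₁ e′∈a with refl ← x∈⁅y⁆⇒x≡y _ e′∈a = new y∈ (joins-unique ja j′)
    where
    new : ∀ {w u v} → w ∈ V → (x ≡ u × w ≡ v) ⊎ (x ≡ v × w ≡ u) → u ∈ V ∪ ⁅ x ⁆ × v ∈ V ∪ ⁅ x ⁆
    new w∈ (inj₁ (refl , refl)) = x∈p∪q⁺ (inj₂ (x∈⁅x⁆ _)) , x∈p∪q⁺ (inj₁ w∈)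
    new w∈ (inj₂ (refl , refl)) = x∈p∪q⁺ (inj₁ w∈) , x∈p∪q⁺ (inj₂ (x∈⁅x⁆ _))
  ...   | inj₂ e′∈b with refl ← x∈⁅y⁆⇒x≡y _ e′∈b with joins-unique jb j′
  ...     | inj₁ (refl , refl) = x∈p∪q⁺ (inj₂ (x∈⁅x⁆ _)) , x∈p∪q⁺ (inj₁ z∈)
  ...     | inj₂ (refl , refl) = x∈p∪q⁺ (inj₁ z∈) , x∈p∪q⁺ (inj₂ (x∈⁅x⁆ _))

  ∂-outside : TwoTree k V E → ∀ {x v} → Carries E x → v ∉ V → ∂ x v ≡ 𝟎
  ∂-outside {E = E} T {x} {v} cx v∉ = trans (𝔽Σ.sum-cong-≗ term) (𝔽Σ.sum-replicate-zero ∣E∣)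
    where
    term : ∀ e → x e ⊗ inc e v ≡ 𝟎
    term e with e ∈? E
    ... | no e∉ = cong (_⊗ inc e v) (off cx e∉)
    ... | yes e∈ with ends∈ T e∈ (inj₁ refl)
    ...   | u∈ , w∈ rewrite δ-≢ {proj₁ (ends e)} {v} (λ { refl → v∉ u∈ })
                          | δ-≢ {proj₂ (ends e)} {v} (λ { refl → v∉ w∈ }) = ⊗-zeroʳ (x e)

  module Ear {k : ℕ} {V : Subset ∣V∣} {E : Subset ∣E∣} {x y z : Vertex} {e a b : Edge} (T : TwoTree k V E) (e∈ : e ∈ E) (je : Joins e y z) (x∉ : x ∉ V)
             (ja : Joins a x y) (jb : Joins b x z) where

    y∈ : y ∈ V
    y∈ = proj₁ (ends∈ T e∈ je)

    z∈ : z ∈ V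
    z∈ = proj₂ (ends∈ T e∈ je)

    a∉ : a ∉ E
    a∉ a∈ = x∉ (proj₁ (ends∈ T a∈ ja))

    b∉ : b ∉ E
    b∉ b∈ = x∉ (proj₁ (ends∈ T b∈ jb))

    a≢b : a ≢ b
    a≢b refl with joins-unique ja jb
    ... | inj₁ (_ , refl) = joins-≢ je refl
    ... | inj₂ (refl , _) = x∉ z∈

    addEar : (Edge → 𝔽₃) → 𝔽₃ → 𝔽₃ → Edge → 𝔽₃
    addEar f s t = f ⊞ (arc ja s ⊞ arc jb t)

    module _ {f : Edge → 𝔽₃} {s t : 𝔽₃} (cf : Carries E f) where

      addEar-carries : s ≢ 𝟎 → t ≢ 𝟎 → Carries (E ∪ ⁅ a ⁆ ∪ ⁅ b ⁆) (addEar f s t)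
      addEar-carries s≢𝟎 t≢𝟎 = carries-⊞ cf
        (carries-⊞ (carries-arc ja s≢𝟎) (carries-arc jb t≢𝟎) λ e∈a e∈b → a≢b (trans (sym (x∈⁅y⁆⇒x≡y a e∈a)) (x∈⁅y⁆⇒x≡y b e∈b)))
        λ e∈E e∈ab → case ∪-inj e∈ab of λ
          { (inj₁ e∈a) → a∉ (subst (_∈ E) (x∈⁅y⁆⇒x≡y a e∈a) e∈E)
          ; (inj₂ e∈b) → b∉ (subst (_∈ E) (x∈⁅y⁆⇒x≡y b e∈b) e∈E) }

      addEar-old : ∀ {e} → e ∈ E → addEar f s t e ≡ f e
      addEar-old {e} e∈ rewrite arc-off ja s {e} (λ { refl → a∉ e∈ }) | arc-off jb t {e} (λ { refl → b∉ e∈ }) =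
        ⊕-identityʳ (f e)

      addEar-a : addEar f s t a ≡ s ⊗ sgn ja
      addEar-a rewrite off cf a∉ | arc-off jb t (a≢b ∘ sym) = trans (⊕-identityʳ _) (arc-at ja s)

      addEar-b : addEar f s t b ≡ t ⊗ sgn jb
      addEar-b rewrite off cf b∉ | arc-off ja s a≢b = arc-at jb t

    ∂-addEar : ∀ f s t v → ∂ (addEar f s t) v ≡ ∂ f v ⊕ (s ⊗ pair (x , y) v ⊕ t ⊗ pair (x , z) v)
    ∂-addEar f s t v = trans (∂-⊞ f (arc ja s ⊞ arc jb t) v) (cong (∂ f v ⊕_)
      (trans (∂-⊞ (arc ja s) (arc jb t) v) (cong₂ _⊕_ (∂-arc ja s v) (∂-arc jb t v))))

  -- Boundaries that the first tree can absorb

  Sol : Subset ∣V∣ → Subset ∣E∣ → Vertex → (Vertex → 𝔽₃) → Set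
  Sol V E r β = ∃ λ f → Carries E f × (∀ {v} → v ∈ V → v ≢ r → ∂ f v ≡ β v)

  sol-cong : ∀ {r β γ} → (∀ {v} → v ∈ V → β v ≡ γ v) → Sol V E r β → Sol V E r γ
  sol-cong β≗γ (f , cf , ∂f) = f , cf , λ v∈ v≢r → trans (∂f v∈ v≢r) (β≗γ v∈)

  -- The vertex at which `Sol` leaves the boundary open. Boundaries sum to zero, so its value there
  -- is forced in the end, and no zero-sum hypothesis on `β` has to pass through the inductions.
  root : TwoTree k V E → Vertex
  root (base {z = z} _)       = z
  root (extend T _ _ _ _ _)   = root T

  root∈ : (T : TwoTree k V E) → root T ∈ V
  root∈ (base _)             = x∈p∪q⁺ (inj₂ (x∈⁅x⁆ _))
  root∈ (extend T _ _ _ _ _) = x∈p∪q⁺ (inj₁ (root∈ T))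

  module _ {k : ℕ} {V : Subset ∣V∣} {E : Subset ∣E∣} {x y z : Vertex} {e a b : Edge} (T : TwoTree k V E) (e∈ : e ∈ E) (je : Joins e y z) (x∉ : x ∉ V)
           (ja : Joins a x y) (jb : Joins b x z) where
    open Ear T e∈ je x∉ ja jb

    -- The ear sends `s` to `y` and `t` to `z`. It must meet the demand at `x` alone, and the rest
    -- of the tree has to make up for what arrives at `y` and `z`.
    sol-extend : ∀ {β s t} → s ≢ 𝟎 → t ≢ 𝟎 → s ⊕ t ≡ β x →
      Sol V E (root T) (λ v → β v ⊕ (s ⊗ δ y v ⊕ t ⊗ δ z v)) →
      Sol (V ∪ ⁅ x ⁆) (E ∪ ⁅ a ⁆ ∪ ⁅ b ⁆) (root T) β
    sol-extend {β} {s} {t} s≢𝟎 t≢𝟎 s+t (f , cf , ∂f) =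
      addEar f s t , addEar-carries cf s≢𝟎 t≢𝟎 , λ {v} v∈ v≢r → trans (∂-addEar f s t v) (at v∈ v≢r (∪-inj v∈))
      where
      atx : ∀ s t → s ⊗ (𝟏 ⊖ 𝟎) ⊕ t ⊗ (𝟏 ⊖ 𝟎) ≡ s ⊕ t
      atx = from-yes (∀₃? λ s → ∀₃? λ t → s ⊗ (𝟏 ⊖ 𝟎) ⊕ t ⊗ (𝟏 ⊖ 𝟎) ≟₃ s ⊕ t)
      old : ∀ b s t p q → b ⊕ (s ⊗ p ⊕ t ⊗ q) ⊕ (s ⊗ (𝟎 ⊖ p) ⊕ t ⊗ (𝟎 ⊖ q)) ≡ b
      old = from-yes (∀₃? λ b → ∀₃? λ s → ∀₃? λ t → ∀₃? λ p → ∀₃? λ q →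
        b ⊕ (s ⊗ p ⊕ t ⊗ q) ⊕ (s ⊗ (𝟎 ⊖ p) ⊕ t ⊗ (𝟎 ⊖ q)) ≟₃ b)
      at : ∀ {v} → v ∈ V ∪ ⁅ x ⁆ → v ≢ root T → v ∈ V ⊎ v ∈ ⁅ x ⁆ →
           ∂ f v ⊕ (s ⊗ pair (x , y) v ⊕ t ⊗ pair (x , z) v) ≡ β v
      at {v} _ v≢r (inj₁ v∈V) rewrite ∂f v∈V v≢r | δ-≢ {x} {v} (λ { refl → x∉ v∈V }) =
        old (β v) s t (δ y v) (δ z v)
      at _ _ (inj₂ v∈x) with refl ← x∈⁅y⁆⇒x≡y x v∈x
        rewrite ∂-outside T cf x∉ | δ-refl x | δ-≢ {y} {x} (λ { refl → x∉ y∈ }) | δ-≢ {z} {x} (λ { refl → x∉ z∈ }) =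
        trans (atx s t) s+t

  splitting : ∀ d → ∃ λ s → ∃ λ t → s ≢ 𝟎 × t ≢ 𝟎 × s ⊕ t ≡ d
  splitting 𝟎 = 𝟏 , 𝟐 , (λ ()) , (λ ()) , refl
  splitting 𝟏 = 𝟐 , 𝟐 , (λ ()) , (λ ()) , refl
  splitting 𝟐 = 𝟏 , 𝟏 , (λ ()) , (λ ()) , refl

  avoid : ∀ (d : Bool → 𝔽₃) {c} → c ≢ 𝟎 → d true ≡ d false ⊕ c → ∀ t → ∃ λ i → d i ⊖ t ≢ 𝟎
  avoid d {c} c≢𝟎 d≡ t with d false ⊖ t ≟₃ 𝟎
  ... | no ≢𝟎  = false , ≢𝟎
  ... | yes ≡𝟎 = true , λ eq → c≢𝟎 (trans (sym (go (d false) c t)) (cong₂ _⊖_ (trans (cong (_⊖ t) (sym d≡)) eq) ≡𝟎))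
    where
    go : ∀ d c t → (d ⊕ c ⊖ t) ⊖ (d ⊖ t) ≡ c
    go = from-yes (∀₃? λ d → ∀₃? λ c → ∀₃? λ t → (d ⊕ c ⊖ t) ⊖ (d ⊖ t) ≟₃ c)

  -- Two boundaries that differ along an edge of the tree: the edge and the
  -- difference act as a pair of parallel edges, which collapses the whole tree.
  Flexible : Subset ∣V∣ → (Bool → Vertex → 𝔽₃) → Vertex → Vertex → Set
  Flexible V β y z = ∃ λ c → c ≢ 𝟎 × (∀ {v} → v ∈ V → β true v ≡ β false v ⊕ c ⊗ pair (y , z) v)

  flexible-sym : ∀ {V} β y z → Flexible V β y z → Flexible V β z y
  flexible-sym β y z (c , c≢𝟎 , eq) =
    ⊝ c , ⊗-nonzero {𝟐} (λ ()) c≢𝟎 , λ {v} v∈ → trans (eq v∈) (cong (β false v ⊕_) (flip c (δ y v) (δ z v)))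
    where
    flip : ∀ c p q → c ⊗ (p ⊖ q) ≡ ⊝ c ⊗ (q ⊖ p)
    flip = from-yes (∀₃? λ c → ∀₃? λ p → ∀₃? λ q → c ⊗ (p ⊖ q) ≟₃ ⊝ c ⊗ (q ⊖ p))

  -- The old edge x–y together with the flexibility along x–y leaves the value on
  -- x–z free, which is flexibility along y–z once x is settled.
  flex-ear : ∀ {β : Bool → Vertex → 𝔽₃} {x y z} {P : (Vertex → 𝔽₃) → Set} → x ∉ V → y ∈ V →
    Flexible (V ∪ ⁅ x ⁆) β x y →
    (∀ γ → Flexible V γ y z → ∃ λ i → P (γ i)) →
    ∃ λ i → ∃ λ s → ∃ λ t → s ≢ 𝟎 × t ≢ 𝟎 × s ⊕ t ≡ β i x × P (λ v → β i v ⊕ (s ⊗ δ y v ⊕ t ⊗ δ z v))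
  flex-ear {V} {β} {x} {y} {z} {P} x∉ y∈ (c , c≢𝟎 , β≡) ih =
    let (t , p) = ih γ (𝟐 , (λ ()) , γ≡) in
    choice t , β (choice t) x ⊖ val t , val t , proj₂ (choose t) , val≢𝟎 t , cancel (β (choice t) x) (val t) , p
    where
    -- The two candidate values on x-z. For each of them at least one of the two boundaries leaves a
    -- nonzero value for x-y.
    val : Bool → 𝔽₃
    val false = 𝟏
    val true  = 𝟐
    val≢𝟎 : ∀ t → val t ≢ 𝟎
    val≢𝟎 false ()
    val≢𝟎 true  ()
    βx : β true x ≡ β false x ⊕ c
    βx = trans (β≡ (x∈p∪q⁺ (inj₂ (x∈⁅x⁆ x)))) (cong (β false x ⊕_)
      (trans (cong (c ⊗_) (cong₂ _⊖_ (δ-refl x) (δ-≢ {y} {x} λ { refl → x∉ y∈ }))) (⊗-identityʳ c)))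
    choose : ∀ t → ∃ λ i → β i x ⊖ val t ≢ 𝟎
    choose t = avoid (λ i → β i x) c≢𝟎 βx (val t)
    choice : Bool → Bool
    choice t = proj₁ (choose t)
    cancel : ∀ d t → d ⊖ t ⊕ t ≡ d
    cancel = from-yes (∀₃? λ d → ∀₃? λ t → d ⊖ t ⊕ t ≟₃ d)
    γ : Bool → Vertex → 𝔽₃
    γ t v = β (choice t) v ⊕ ((β (choice t) x ⊖ val t) ⊗ δ y v ⊕ val t ⊗ δ z v)
    -- On `V` the settled boundary depends on `t` only: the two boundaries differ along x-y, and at
    -- `y` this is cancelled by the change of the value on x-y.
    normal : Vertex → 𝔽₃ → 𝔽₃
    normal v t = β false v ⊕ β false x ⊗ δ y v ⊕ t ⊗ (δ z v ⊖ δ y v)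
    normal₀ : ∀ b d t p q → b ⊕ ((d ⊖ t) ⊗ p ⊕ t ⊗ q) ≡ b ⊕ d ⊗ p ⊕ t ⊗ (q ⊖ p)
    normal₀ = from-yes (∀₃? λ b → ∀₃? λ d → ∀₃? λ t → ∀₃? λ p → ∀₃? λ q →
      b ⊕ ((d ⊖ t) ⊗ p ⊕ t ⊗ q) ≟₃ b ⊕ d ⊗ p ⊕ t ⊗ (q ⊖ p))
    shift : ∀ b c p d → b ⊕ c ⊗ (𝟎 ⊖ p) ⊕ (d ⊕ c) ⊗ p ≡ b ⊕ d ⊗ p
    shift = from-yes (∀₃? λ b → ∀₃? λ c → ∀₃? λ p → ∀₃? λ d → b ⊕ c ⊗ (𝟎 ⊖ p) ⊕ (d ⊕ c) ⊗ p ≟₃ b ⊕ d ⊗ p)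
    normal-form : ∀ i t {v} → v ∈ V → β i v ⊕ ((β i x ⊖ t) ⊗ δ y v ⊕ t ⊗ δ z v) ≡ normal v t
    normal-form false t {v} v∈ = normal₀ (β false v) (β false x) t (δ y v) (δ z v)
    normal-form true  t {v} v∈ = trans (normal₀ (β true v) (β true x) t (δ y v) (δ z v))
      (cong (_⊕ t ⊗ (δ z v ⊖ δ y v)) (trans (cong₂ (λ b d → b ⊕ d ⊗ δ y v) (β≡ (x∈p∪q⁺ (inj₁ v∈))) βx)
        (trans (cong (λ q → β false v ⊕ c ⊗ (q ⊖ δ y v) ⊕ (β false x ⊕ c) ⊗ δ y v) (δ-≢ {x} {v} λ { refl → x∉ v∈ }))
               (shift (β false v) c (δ y v) (β false x)))))
    step : ∀ b p q → b ⊕ 𝟐 ⊗ (q ⊖ p) ≡ b ⊕ 𝟏 ⊗ (q ⊖ p) ⊕ 𝟐 ⊗ (p ⊖ q)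
    step = from-yes (∀₃? λ b → ∀₃? λ p → ∀₃? λ q → b ⊕ 𝟐 ⊗ (q ⊖ p) ≟₃ b ⊕ 𝟏 ⊗ (q ⊖ p) ⊕ 𝟐 ⊗ (p ⊖ q))
    γ≡ : ∀ {v} → v ∈ V → γ true v ≡ γ false v ⊕ 𝟐 ⊗ pair (y , z) v
    γ≡ {v} v∈ = begin
      γ true v                                    ≡⟨ normal-form (choice true) 𝟐 v∈ ⟩
      normal v 𝟐                                  ≡⟨ step (β false v ⊕ β false x ⊗ δ y v) (δ y v) (δ z v) ⟩
      normal v 𝟏 ⊕ 𝟐 ⊗ pair (y , z) v             ≡⟨ cong (_⊕ 𝟐 ⊗ pair (y , z) v) (normal-form (choice false) 𝟏 v∈) ⟨
      γ false v ⊕ 𝟐 ⊗ pair (y , z) v              ∎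
      where open ≡-Reasoning

  sol-base : ∀ {e y z β} (j : Joins e y z) → β y ≢ 𝟎 → Sol (⁅ y ⁆ ∪ ⁅ z ⁆) ⁅ e ⁆ z β
  sol-base {y = y} {z} {β} j βy≢𝟎 = arc j (β y) , carries-arc j βy≢𝟎 , at
    where
    at : ∀ {v} → v ∈ ⁅ y ⁆ ∪ ⁅ z ⁆ → v ≢ z → ∂ (arc j (β y)) v ≡ β v
    at v∈ v≢z with ∪-inj v∈
    ... | inj₂ v∈z = contradiction (x∈⁅y⁆⇒x≡y z v∈z) v≢z
    ... | inj₁ v∈y with refl ← x∈⁅y⁆⇒x≡y y v∈y = trans (∂-arc j (β y) y)
      (trans (cong₂ (λ p q → β y ⊗ (p ⊖ q)) (δ-refl y) (δ-≢ (joins-≢ j ∘ sym))) (⊗-identityʳ (β y)))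

  -- The last ear is removed. If the flexible edge belongs to it, `flex-ear` moves the flexibility
  -- to the edge below the ear; otherwise both boundaries agree at `x`, and any splitting of that
  -- value will do. On the base edge, one of two different values is nonzero.
  flex : (T : TwoTree k V E) → ∀ {e y z} → e ∈ E → Joins e y z → ∀ β → Flexible V β y z →
         ∃ λ i → Sol V E (root T) (β i)
  flex (base {e} {y} {z} j) e′∈ j′ β fl with refl ← x∈⁅y⁆⇒x≡y e e′∈ =
    finish (normalise (joins-unique j j′) fl)
    where
    normalise : ∀ {u v} → (y ≡ u × z ≡ v) ⊎ (y ≡ v × z ≡ u) → Flexible _ β u v → Flexible _ β y z
    normalise (inj₁ (refl , refl)) fl = fl
    normalise (inj₂ (refl , refl)) fl = flexible-sym β z y fl
    finish : Flexible (⁅ y ⁆ ∪ ⁅ z ⁆) β y z → ∃ λ i → Sol _ _ z (β i)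
    finish (c , c≢𝟎 , β≡) with avoid (λ i → β i y) c≢𝟎
      (trans (β≡ (x∈p∪q⁺ (inj₁ (x∈⁅x⁆ y)))) (cong (β false y ⊕_)
        (trans (cong (c ⊗_) (cong₂ _⊖_ (δ-refl y) (δ-≢ (joins-≢ j ∘ sym)))) (⊗-identityʳ c)))) 𝟎
    ... | i , ≢𝟎 = i , sol-base j (≢𝟎 ∘ trans (⊕-identityʳ (β i y)))
  flex (extend {V = V} {E} {x} {y} {z} {e} {a} {b} T e∈ je x∉ ja jb) {_} {u} {v} e′∈ j′ β fl with ∪-inj e′∈
  ... | inj₁ e′∈E =
    let (c , c≢𝟎 , β≡) = fl
        (u∈ , v∈) = ends∈ T e′∈E j′
        (s , t , s≢𝟎 , t≢𝟎 , s+t) = splitting (β false x)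
        extra = λ w → s ⊗ δ y w ⊕ t ⊗ δ z w
        (i , sol) = flex T e′∈E j′ (λ i w → β i w ⊕ extra w)
          (c , c≢𝟎 , λ {w} w∈ → trans (cong (_⊕ extra w) (β≡ (x∈p∪q⁺ (inj₁ w∈))))
                                      (swap (β false w) (c ⊗ pair (u , v) w) (extra w)))
        βx : β true x ≡ β false x
        βx = trans (β≡ (x∈p∪q⁺ (inj₂ (x∈⁅x⁆ x)))) (trans (cong (β false x ⊕_)
          (trans (cong₂ (λ p q → c ⊗ (p ⊖ q)) (δ-≢ {u} {x} λ { refl → x∉ u∈ }) (δ-≢ {v} {x} λ { refl → x∉ v∈ })) (⊗-zeroʳ c)))
          (⊕-identityʳ (β false x)))
    in i , sol-extend T e∈ je x∉ ja jb s≢𝟎 t≢𝟎 (trans s+t (same (λ i → β i x) βx i)) sol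
    where
    swap : ∀ p q r → p ⊕ q ⊕ r ≡ p ⊕ r ⊕ q
    swap = from-yes (∀₃? λ p → ∀₃? λ q → ∀₃? λ r → p ⊕ q ⊕ r ≟₃ p ⊕ r ⊕ q)
    same : ∀ (d : Bool → 𝔽₃) → d true ≡ d false → ∀ i → d false ≡ d i
    same d eq false = refl
    same d eq true  = sym eq
  ... | inj₂ e′∈ab with ∪-inj e′∈ab
  ...   | inj₁ e′∈a with refl ← x∈⁅y⁆⇒x≡y a e′∈a =
    let (i , s , t , s≢𝟎 , t≢𝟎 , s+t , sol) = flex-ear {β = β} {z = z} {P = Sol V E (root T)} x∉ (proj₁ (ends∈ T e∈ je))
          (normalise (joins-unique ja j′) fl) (flex T e∈ je)
    in i , sol-extend T e∈ je x∉ ja jb s≢𝟎 t≢𝟎 s+t sol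
    where
    normalise : ∀ {u v} → (x ≡ u × y ≡ v) ⊎ (x ≡ v × y ≡ u) → Flexible _ β u v → Flexible _ β x y
    normalise (inj₁ (refl , refl)) fl = fl
    normalise (inj₂ (refl , refl)) fl = flexible-sym β y x fl
  ...   | inj₂ e′∈b with refl ← x∈⁅y⁆⇒x≡y b e′∈b =
    let (i , s , t , s≢𝟎 , t≢𝟎 , s+t , sol) = flex-ear {β = β} {z = y} {P = Sol V E (root T)} x∉ (proj₂ (ends∈ T e∈ je))
          (normalise (joins-unique jb j′) fl) (flex T e∈ (joins-sym je))
    in i , sol-extend T e∈ je x∉ ja jb t≢𝟎 s≢𝟎 (trans (⊕-comm t s) s+t)
             (sol-cong (λ {w} _ → cong (β i w ⊕_) (⊕-comm (s ⊗ δ z w) (t ⊗ δ y w))) sol)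
    where
    normalise : ∀ {u v} → (x ≡ u × z ≡ v) ⊎ (x ≡ v × z ≡ u) → Flexible _ β u v → Flexible _ β x z
    normalise (inj₁ (refl , refl)) fl = fl
    normalise (inj₂ (refl , refl)) fl = flexible-sym β z x fl

  -- Away from `x` this subtracts `β x` times the indicator vector of the triangle xyz. It is what
  -- an ear with nonzero demand d forces: two nonzero values with sum d are both -d.
  reduce : (x y z : Vertex) → (Vertex → 𝔽₃) → Vertex → 𝔽₃
  reduce x y z β v = β v ⊖ β x ⊗ (δ y v ⊕ δ z v)

  -- Fails exactly if all triangle coordinates of `β` are nonzero and its coordinate at the base
  -- edge is zero.
  Good : TwoTree k V E → (Vertex → 𝔽₃) → Set
  Good (base {y = y} _) β = β y ≢ 𝟎
  Good (extend {x = x} {y} {z} T _ _ _ _ _) β = β x ≡ 𝟎 ⊎ Good T (reduce x y z β)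

  reduce-cong : ∀ x y z {β γ} → (∀ v → β v ≡ γ v) → ∀ v → reduce x y z β v ≡ reduce x y z γ v
  reduce-cong x y z eq v = cong₂ (λ p q → p ⊖ q ⊗ (δ y v ⊕ δ z v)) (eq v) (eq x)

  good-cong : (T : TwoTree k V E) → ∀ {β γ} → (∀ v → β v ≡ γ v) → Good T β → Good T γ
  good-cong (base _) eq βy≢𝟎 γy≡𝟎 = βy≢𝟎 (trans (eq _) γy≡𝟎)
  good-cong (extend T _ _ _ _ _) eq (inj₁ βx≡𝟎) = inj₁ (trans (sym (eq _)) βx≡𝟎)
  good-cong (extend {x = x} {y} {z} T _ _ _ _ _) eq (inj₂ good) = inj₂ (good-cong T (reduce-cong x y z eq) good)

  -- At an ear x with β x ≢ 𝟎 both edges are forced; with β x ≡ 𝟎 the path y x z can be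
  -- directed either way and plays the part of a second edge between y and z.
  good⇒sol : (T : TwoTree k V E) → ∀ {β} → Good T β → Sol V E (root T) β
  good⇒sol (base j) βy≢𝟎 = sol-base j βy≢𝟎
  good⇒sol (extend {V = V} {E} {x} {y} {z} T e∈ je x∉ ja jb) {β} good with β x ≟₃ 𝟎
  ... | yes βx≡𝟎 = settle (flex T e∈ je γ (𝟏 , (λ ()) , λ {v} _ → shift (β v) (δ y v) (δ z v)))
    where
    val : Bool → 𝔽₃
    val false = 𝟏
    val true  = 𝟐
    γ : Bool → Vertex → 𝔽₃
    γ i v = β v ⊕ (val i ⊗ δ y v ⊕ ⊝ val i ⊗ δ z v)
    shift : ∀ b p q → b ⊕ (𝟐 ⊗ p ⊕ 𝟏 ⊗ q) ≡ b ⊕ (𝟏 ⊗ p ⊕ 𝟐 ⊗ q) ⊕ 𝟏 ⊗ (p ⊖ q)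
    shift = from-yes (∀₃? λ b → ∀₃? λ p → ∀₃? λ q → b ⊕ (𝟐 ⊗ p ⊕ 𝟏 ⊗ q) ≟₃ b ⊕ (𝟏 ⊗ p ⊕ 𝟐 ⊗ q) ⊕ 𝟏 ⊗ (p ⊖ q))
    settle : (∃ λ i → Sol V E (root T) (γ i)) → Sol _ _ (root T) β
    settle (false , sol) = sol-extend T e∈ je x∉ ja jb {β} {𝟏} {𝟐} (λ ()) (λ ()) (sym βx≡𝟎) sol
    settle (true  , sol) = sol-extend T e∈ je x∉ ja jb {β} {𝟐} {𝟏} (λ ()) (λ ()) (sym βx≡𝟎) sol
  ... | no βx≢𝟎 with good
  ...   | inj₁ βx≡𝟎 = contradiction βx≡𝟎 βx≢𝟎
  ...   | inj₂ good′ = sol-extend T e∈ je x∉ ja jb {s = ⊝ β x} {⊝ β x} ⊝βx≢𝟎 ⊝βx≢𝟎 (twice (β x))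
          (sol-cong (λ {v} _ → spread (β v) (β x) (δ y v) (δ z v)) (good⇒sol T good′))
    where
    ⊝βx≢𝟎 : ⊝ β x ≢ 𝟎
    ⊝βx≢𝟎 = ⊗-nonzero {𝟐} (λ ()) βx≢𝟎
    twice : ∀ d → ⊝ d ⊕ ⊝ d ≡ d
    twice = from-yes (∀₃? λ d → ⊝ d ⊕ ⊝ d ≟₃ d)
    spread : ∀ b d p q → b ⊖ d ⊗ (p ⊕ q) ≡ b ⊕ (⊝ d ⊗ p ⊕ ⊝ d ⊗ q)
    spread = from-yes (∀₃? λ b → ∀₃? λ d → ∀₃? λ p → ∀₃? λ q → b ⊖ d ⊗ (p ⊕ q) ≟₃ b ⊕ (⊝ d ⊗ p ⊕ ⊝ d ⊗ q))

  -- Choice of signs, and coordinates with respect to the triangles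

  signed : Bool → 𝔽₃
  signed true  = 𝟏
  signed false = 𝟐

  signed≢𝟎 : ∀ s → signed s ≢ 𝟎
  signed≢𝟎 true  ()
  signed≢𝟎 false ()

  dot : Vec 𝔽₃ ℓ → Vec Bool ℓ → 𝔽₃
  dot []       []       = 𝟎
  dot (c ∷ cs) (s ∷ ss) = signed s ⊗ c ⊕ dot cs ss

  comb : Vec (Vertex → 𝔽₃) ℓ → Vec Bool ℓ → Vertex → 𝔽₃
  comb us ss v = dot (Vec.map (λ u → u v) us) ss

  comb-++ : ∀ (us : Vec _ ℓ) (ws : Vec _ m) ss ts v →
    comb (us Vec.++ ws) (ss Vec.++ ts) v ≡ comb us ss v ⊕ comb ws ts v
  comb-++ []       ws []       ts v = refl
  comb-++ (u ∷ us) ws (s ∷ ss) ts v =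
    trans (cong (signed s ⊗ u v ⊕_) (comb-++ us ws ss ts v)) (sym (⊕-assoc (signed s ⊗ u v) _ _))

  count : Vec 𝔽₃ ℓ → ℕ
  count cs = Vec.sum (Vec.map nonzero cs)

  nonzero≡0 : ∀ {c} → nonzero c ≡ 0 → c ≡ 𝟎
  nonzero≡0 {𝟎} _ = refl

  dot-zero : (cs : Vec 𝔽₃ ℓ) → count cs ≡ 0 → ∀ ss → dot cs ss ≡ 𝟎
  dot-zero []       _  []       = refl
  dot-zero (𝟎 ∷ cs) c0 (s ∷ ss) rewrite ⊗-zeroʳ (signed s) = dot-zero cs c0 ss

  match : ∀ c τ → c ≢ 𝟎 → τ ≢ 𝟎 → ∃ λ s → signed s ⊗ c ≡ τ
  match 𝟎 _ c≢𝟎 _   = contradiction refl c≢𝟎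
  match 𝟏 𝟎 _   τ≢𝟎 = contradiction refl τ≢𝟎
  match 𝟏 𝟏 _   _   = true  , refl
  match 𝟏 𝟐 _   _   = false , refl
  match 𝟐 𝟎 _   τ≢𝟎 = contradiction refl τ≢𝟎
  match 𝟐 𝟏 _   _   = false , refl
  match 𝟐 𝟐 _   _   = true  , refl

  -- A single nonzero entry is given the right sign. With more of them, the first entry and the rest
  -- both contribute -τ, and -τ - τ = τ.
  dot-reach : (cs : Vec 𝔽₃ ℓ) → count cs ≢ 0 → ∀ {τ} → τ ≢ 𝟎 → ∃ λ ss → dot cs ss ≡ τ
  dot-reach []       c≢0 τ≢𝟎 = contradiction refl c≢0
  dot-reach (c ∷ cs) c≢0 {τ} τ≢𝟎 with c ≟₃ 𝟎 | count cs ℕ.≟ 0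
  ... | yes refl | _ = let (ss , eq) = dot-reach cs c≢0 τ≢𝟎 in true ∷ ss , eq
  ... | no c≢𝟎 | yes rest≡0 = let (s , eq) = match c τ c≢𝟎 τ≢𝟎 in
    s ∷ Vec.replicate _ true , trans (cong₂ _⊕_ eq (dot-zero cs rest≡0 _)) (⊕-identityʳ τ)
  ... | no c≢𝟎 | no rest≢0 =
    let (s , eq) = match c (⊝ τ) c≢𝟎 (⊗-nonzero {𝟐} (λ ()) τ≢𝟎)
        (ss , eq′) = dot-reach cs rest≢0 {⊝ τ} (⊗-nonzero {𝟐} (λ ()) τ≢𝟎)
    in s ∷ ss , trans (cong₂ _⊕_ eq eq′) (twice τ)
    where
    twice : ∀ d → ⊝ d ⊕ ⊝ d ≡ d
    twice = from-yes (∀₃? λ d → ⊝ d ⊕ ⊝ d ≟₃ d)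

  -- If there are at least two nonzero entries, those after the first can be made to cancel it by
  -- `dot-reach`.
  dot-reach-𝟎 : (cs : Vec 𝔽₃ ℓ) → count cs ≢ 1 → ∃ λ ss → dot cs ss ≡ 𝟎
  dot-reach-𝟎 []       _   = [] , refl
  dot-reach-𝟎 (c ∷ cs) c≢1 with c ≟₃ 𝟎
  ... | yes refl = let (ss , eq) = dot-reach-𝟎 cs c≢1 in true ∷ ss , eq
  ... | no c≢𝟎 = let (ss , eq) = dot-reach cs (λ c0 → c≢1 (cong₂ ℕ._+_ (nonzero≡1 c≢𝟎) c0)) (⊗-nonzero {𝟐} (λ ()) c≢𝟎) in
    true ∷ ss , trans (cong (c ⊕_) eq) (cancel c)
    where
    nonzero≡1 : ∀ {c} → c ≢ 𝟎 → nonzero c ≡ 1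
    nonzero≡1 {𝟎} c≢𝟎 = contradiction refl c≢𝟎
    nonzero≡1 {𝟏} _   = refl
    nonzero≡1 {𝟐} _   = refl
    cancel : ∀ c → c ⊖ c ≡ 𝟎
    cancel = from-yes (∀₃? λ c → c ⊖ c ≟₃ 𝟎)

  -- The coordinates of a vector in the basis formed by the triangles (indicator
  -- vectors) and one base edge: `weight` counts the nonzero triangle coordinates,
  -- `residue` is the one at the base edge.
  weight : TwoTree k V E → (Vertex → 𝔽₃) → ℕ
  weight (base _) u = 0
  weight (extend {x = x} {y} {z} T _ _ _ _ _) u = nonzero (u x) ℕ.+ weight T (reduce x y z u)

  residue : TwoTree k V E → (Vertex → 𝔽₃) → 𝔽₃
  residue (base {y = y} _) u = u y
  residue (extend {x = x} {y} {z} T _ _ _ _ _) u = residue T (reduce x y z u)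

  weight-cong : (T : TwoTree k V E) → ∀ {u w} → (∀ v → u v ≡ w v) → weight T u ≡ weight T w
  weight-cong (base _) eq = refl
  weight-cong (extend {x = x} {y} {z} T _ _ _ _ _) eq =
    cong₂ ℕ._+_ (cong nonzero (eq x)) (weight-cong T (reduce-cong x y z eq))

  residue-cong : (T : TwoTree k V E) → ∀ {u w} → (∀ v → u v ≡ w v) → residue T u ≡ residue T w
  residue-cong (base _) eq = eq _
  residue-cong (extend {x = x} {y} {z} T _ _ _ _ _) eq = residue-cong T (reduce-cong x y z eq)

  reduce-comb : ∀ x y z (us : Vec _ ℓ) ss v →
    comb (Vec.map (reduce x y z) us) ss v ≡ reduce x y z (comb us ss) v
  reduce-comb x y z []       []       v = refl
  reduce-comb x y z (u ∷ us) (s ∷ ss) v = trans (cong (signed s ⊗ reduce x y z u v ⊕_) (reduce-comb x y z us ss v))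
    (linear (signed s) (u v) (u x) (comb us ss v) (comb us ss x) (δ y v ⊕ δ z v))
    where
    linear : ∀ s a b c d p → s ⊗ (a ⊖ b ⊗ p) ⊕ (c ⊖ d ⊗ p) ≡ (s ⊗ a ⊕ c) ⊖ (s ⊗ b ⊕ d) ⊗ p
    linear = from-yes (∀₃? λ s → ∀₃? λ a → ∀₃? λ b → ∀₃? λ c → ∀₃? λ d → ∀₃? λ p →
      s ⊗ (a ⊖ b ⊗ p) ⊕ (c ⊖ d ⊗ p) ≟₃ (s ⊗ a ⊕ c) ⊖ (s ⊗ b ⊕ d) ⊗ p)

  -- If every choice of signs is bad, then each triangle coordinate is nonzero for
  -- exactly one of the vectors, so their weights add up to the number of triangles.
  select : (T : TwoTree k V E) (us : Vec (Vertex → 𝔽₃) ℓ) →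
    count (Vec.map (residue T) us) ≢ 0 ⊎ Vec.sum (Vec.map (weight T) us) ≢ k →
    ∃ λ ss → Good T (comb us ss)
  select (base {y = y} _) us (inj₁ r≢0) =
    let (ss , eq) = dot-reach (Vec.map (λ u → u y) us) r≢0 {𝟏} (λ ()) in ss , λ ≡𝟎 → case trans (sym eq) ≡𝟎 of λ ()
  select (base _) us (inj₂ w≢0) = contradiction (zeros us) w≢0
    where
    zeros : (us : Vec (Vertex → 𝔽₃) ℓ) → Vec.sum (Vec.map (λ _ → 0) us) ≡ 0
    zeros []       = refl
    zeros (u ∷ us) = zeros us
  select {suc k} (extend {x = x} {y} {z} T e∈ je x∉ ja jb) us hyp with count (Vec.map (λ u → u x) us) ℕ.≟ 1
  -- Unless exactly one vector involves the triangle at `x`, suitable signs cancel the demand at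
  -- `x`, and nothing more is required.
  ... | no c≢1 = let (ss , eq) = dot-reach-𝟎 (Vec.map (λ u → u x) us) c≢1 in ss , inj₁ eq
  ... | yes c≡1 = let (ss , good) = select T (Vec.map (reduce x y z) us) (transfer hyp) in
    ss , inj₂ (good-cong T (reduce-comb x y z us ss) good)
    where
    additive : (us : Vec (Vertex → 𝔽₃) ℓ) → Vec.sum (Vec.map (weight (extend T e∈ je x∉ ja jb)) us) ≡
      count (Vec.map (λ u → u x) us) ℕ.+ Vec.sum (Vec.map (weight T) (Vec.map (reduce x y z) us))
    additive []       = refl
    additive (u ∷ us) = trans (cong (nonzero (u x) ℕ.+ weight T (reduce x y z u) ℕ.+_) (additive us))
      (interchange (nonzero (u x)) (weight T (reduce x y z u)) _ _)
      where
      interchange : ∀ a b c d → a ℕ.+ b ℕ.+ (c ℕ.+ d) ≡ a ℕ.+ c ℕ.+ (b ℕ.+ d)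
      interchange = ℕ-solve-∀
    transfer : count (Vec.map (residue (extend T e∈ je x∉ ja jb)) us) ≢ 0 ⊎
               Vec.sum (Vec.map (weight (extend T e∈ je x∉ ja jb)) us) ≢ suc k →
               count (Vec.map (residue T) (Vec.map (reduce x y z) us)) ≢ 0 ⊎
               Vec.sum (Vec.map (weight T) (Vec.map (reduce x y z) us)) ≢ k
    transfer (inj₁ r≢0) = inj₁ (r≢0 ∘ trans (cong count (Vec.map-∘ (residue T) (reduce x y z) us)))
    transfer (inj₂ w≢)  = inj₂ λ eq → w≢ (trans (additive us) (cong₂ ℕ._+_ c≡1 eq))

  -- If all coordinates were zero, no reduction would change the vector, and it would vanish at
  -- every vertex except the root.
  nonvanishing : (T : TwoTree k V E) → ∀ {u v} → v ∈ V → v ≢ root T → u v ≢ 𝟎 →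
    residue T u ≢ 𝟎 ⊎ 1 ℕ.≤ weight T u
  nonvanishing (base {y = y} {z} _) v∈ v≢z uv≢𝟎 with ∪-inj v∈
  ... | inj₁ v∈y with refl ← x∈⁅y⁆⇒x≡y y v∈y = inj₁ uv≢𝟎
  ... | inj₂ v∈z = contradiction (x∈⁅y⁆⇒x≡y z v∈z) v≢z
  nonvanishing (extend {x = x} {y} {z} T _ _ x∉ _ _) {u} {v} v∈ v≢r uv≢𝟎 with u x in ux≡
  ... | 𝟏 = inj₂ (ℕ.s≤s ℕ.z≤n)
  ... | 𝟐 = inj₂ (ℕ.s≤s ℕ.z≤n)
  ... | 𝟎 with ∪-inj v∈
  ...   | inj₂ v∈x with refl ← x∈⁅y⁆⇒x≡y x v∈x = contradiction ux≡ uv≢𝟎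
  ...   | inj₁ v∈V = nonvanishing T v∈V v≢r
          (uv≢𝟎 ∘ trans (sym (⊕-identityʳ (u v))))

  δ≢𝟐 : ∀ u v → δ u v ≢ 𝟐
  δ≢𝟐 u v with does (u ≟ v)
  ... | true  = λ ()
  ... | false = λ ()

  off-root : (T : TwoTree k V E) → ∀ {e y z} → e ∈ E → Joins e y z →
    ∃ λ v → v ∈ V × v ≢ root T × δ y v ⊕ δ z v ≡ 𝟏
  off-root T {y = y} {z} e∈ je with y ≟ root T | ends∈ T e∈ je
  ... | no y≢r   | y∈ , _ = y , y∈ , y≢r , cong₂ _⊕_ (δ-refl y) (δ-≢ (joins-≢ je ∘ sym))
  ... | yes refl | _ , z∈ = z , z∈ , joins-≢ je ∘ sym , cong₂ _⊕_ (δ-≢ (joins-≢ je)) (δ-refl z)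

  -- If neither vertex is the tip `x` of the last ear, reduction changes nothing. If one is, the
  -- coordinate at `x` is nonzero, and up to sign the reduced vector is the other vertex plus `y`
  -- plus `z`. Its value at an end of yz off the root is 1 or 2, so a further coordinate is nonzero.
  pair-coordinates : (T : TwoTree k V E) → ∀ {a b} → a ∈ V → b ∈ V → a ≢ b →
    residue T (pair (a , b)) ≢ 𝟎 ⊎ 2 ℕ.≤ weight T (pair (a , b))
  pair-coordinates (base {y = y} {z} j) a∈ b∈ a≢b with ∪-inj a∈ | ∪-inj b∈
  ... | inj₁ a∈y | inj₁ b∈y = contradiction (trans (x∈⁅y⁆⇒x≡y y a∈y) (sym (x∈⁅y⁆⇒x≡y y b∈y))) a≢b
  ... | inj₂ a∈z | inj₂ b∈z = contradiction (trans (x∈⁅y⁆⇒x≡y z a∈z) (sym (x∈⁅y⁆⇒x≡y z b∈z))) a≢b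
  ... | inj₁ a∈y | inj₂ b∈z with refl ← x∈⁅y⁆⇒x≡y y a∈y | refl ← x∈⁅y⁆⇒x≡y z b∈z
    rewrite δ-refl y | δ-≢ (a≢b ∘ sym) = inj₁ λ ()
  ... | inj₂ a∈z | inj₁ b∈y with refl ← x∈⁅y⁆⇒x≡y z a∈z | refl ← x∈⁅y⁆⇒x≡y y b∈y
    rewrite δ-refl y | δ-≢ a≢b = inj₁ λ ()
  pair-coordinates (extend {V = V} {x = x} {y} {z} T e∈ je x∉ ja jb) {a} {b} a∈ b∈ a≢b with ∪-inj a∈ | ∪-inj b∈
  ... | inj₂ a∈x | inj₂ b∈x = contradiction (trans (x∈⁅y⁆⇒x≡y x a∈x) (sym (x∈⁅y⁆⇒x≡y x b∈x))) a≢b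
  ... | inj₁ a∈V | inj₁ b∈V with pair-coordinates T a∈V b∈V a≢b
  ...   | inj₁ r≢𝟎 = inj₁ (r≢𝟎 ∘ trans (residue-cong T unchanged))
    where
    unchanged : ∀ v → pair (a , b) v ≡ reduce x y z (pair (a , b)) v
    unchanged v rewrite δ-≢ {a} {x} (λ { refl → x∉ a∈V }) | δ-≢ {b} {x} (λ { refl → x∉ b∈V }) = sym (⊕-identityʳ _)
  ...   | inj₂ w≥2 = inj₂ (ℕ.≤-trans w≥2 (ℕ.≤-trans (ℕ.≤-reflexive (weight-cong T unchanged)) (ℕ.m≤n+m _ _)))
    where
    unchanged : ∀ v → pair (a , b) v ≡ reduce x y z (pair (a , b)) v
    unchanged v rewrite δ-≢ {a} {x} (λ { refl → x∉ a∈V }) | δ-≢ {b} {x} (λ { refl → x∉ b∈V }) = sym (⊕-identityʳ _)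
  pair-coordinates (extend {V = V} {x = x} {y} {z} T e∈ je x∉ ja jb) {a} {b} a∈ b∈ a≢b | inj₂ a∈x | inj₁ b∈V
    with refl ← x∈⁅y⁆⇒x≡y x a∈x | v , v∈ , v≢r , yz ← off-root T e∈ je =
    Sum.map₂ (λ w≥1 → ℕ.+-mono-≤ (ℕ.≤-reflexive (sym (cong nonzero ux≡))) w≥1) (nonvanishing T v∈ v≢r value)
    where
    ux≡ : pair (x , b) x ≡ 𝟏
    ux≡ = cong₂ _⊖_ (δ-refl x) (δ-≢ (a≢b ∘ sym))
    value : reduce x y z (pair (x , b)) v ≢ 𝟎
    value eq = go (δ b v) (δ≢𝟐 b v) (trans (sym (cong₂ (λ p q → p ⊖ δ b v ⊖ q) (δ-≢ {x} {v} λ { refl → x∉ v∈ }) (cong₂ _⊗_ ux≡ yz))) eq)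
      where
      go : ∀ q → q ≢ 𝟐 → 𝟎 ⊖ q ⊖ 𝟏 ⊗ 𝟏 ≢ 𝟎
      go 𝟎 _ ()
      go 𝟏 _ ()
      go 𝟐 q≢𝟐 _ = q≢𝟐 refl
  pair-coordinates (extend {V = V} {x = x} {y} {z} T e∈ je x∉ ja jb) {a} {b} a∈ b∈ a≢b | inj₁ a∈V | inj₂ b∈x
    with refl ← x∈⁅y⁆⇒x≡y x b∈x | v , v∈ , v≢r , yz ← off-root T e∈ je =
    Sum.map₂ (λ w≥1 → ℕ.+-mono-≤ (ℕ.≤-reflexive (sym (cong nonzero ux≡))) w≥1) (nonvanishing T v∈ v≢r value)
    where
    ux≡ : pair (a , x) x ≡ 𝟐
    ux≡ = cong₂ _⊖_ (δ-≢ a≢b) (δ-refl x)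
    value : reduce x y z (pair (a , x)) v ≢ 𝟎
    value eq = go (δ a v) (δ≢𝟐 a v) (trans (sym (cong₂ (λ p q → δ a v ⊖ p ⊖ q) (δ-≢ {x} {v} λ { refl → x∉ v∈ }) (cong₂ _⊗_ ux≡ yz))) eq)
      where
      go : ∀ p → p ≢ 𝟐 → p ⊖ 𝟎 ⊖ 𝟐 ⊗ 𝟏 ≢ 𝟎
      go 𝟎 _ ()
      go 𝟏 _ ()
      go 𝟐 p≢𝟐 _ = p≢𝟐 refl

  -- Strong orientations of the second tree, and the remaining edges

  Connected : Subset ∣V∣ → (Edge → 𝔽₃) → Set
  Connected V f = ∀ {u v} → u ∈ V → v ∈ V → Star (Arc f) u v

  forward : ∀ {f e u v} (j : Joins e u v) → f e ≡ 𝟏 ⊗ sgn j → Arc f u v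
  forward j eq = _ , j , eq

  backward : ∀ {f e u v} (j : Joins e u v) → f e ≡ 𝟐 ⊗ sgn j → Arc f v u
  backward j@(inj₁ _) eq = _ , joins-sym j , eq
  backward j@(inj₂ _) eq = _ , joins-sym j , eq

  arc-mono : ∀ {f g} → Carries E f → (∀ {e} → e ∈ E → g e ≡ f e) → ∀ {u v} → Arc f u v → Arc g u v
  arc-mono {E = E} cf g≡f (e , j , eq) with e ∈? E
  ... | yes e∈ = e , j , trans (g≡f e∈) eq
  ... | no  e∉ = contradiction (trans (sym eq) (off cf e∉)) (sgn≢𝟎 j)

  connected-mono : ∀ {f g} → Carries E f → (∀ {e} → e ∈ E → g e ≡ f e) → Connected V f → Connected V g
  connected-mono cf g≡f conn u∈ v∈ = Star.map (arc-mono cf g≡f) (conn u∈ v∈)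

  connected-ear : ∀ {f x u v} → Connected V f → u ∈ V → v ∈ V → Arc f u x → Arc f x v → Connected (V ∪ ⁅ x ⁆) f
  connected-ear {x = x} conn u∈ v∈ ux xv p∈ q∈ with ∪-inj p∈ | ∪-inj q∈
  ... | inj₁ p∈V | inj₁ q∈V = conn p∈V q∈V
  ... | inj₁ p∈V | inj₂ q∈x with refl ← x∈⁅y⁆⇒x≡y x q∈x = conn p∈V u∈ ◅◅ ux ◅ ε
  ... | inj₂ p∈x | inj₁ q∈V with refl ← x∈⁅y⁆⇒x≡y x p∈x = xv ◅ conn v∈ q∈V
  ... | inj₂ p∈x | inj₂ q∈x with refl ← x∈⁅y⁆⇒x≡y x p∈x | refl ← x∈⁅y⁆⇒x≡y x q∈x = ε

  -- The strong orientations of a triangle-tree obtained from a directed triangle by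
  -- directing each further ear y x z from y to z or from z to y.
  eared : TwoTree (suc m) V E → ∃ λ (ps : Vec (Vertex × Vertex) m) →
    VAll (λ (a , b) → a ≢ b) ps ×
    (∀ ss → ∃ λ f → Carries E f × (∀ v → ∂ f v ≡ comb (Vec.map pair ps) ss v) × Connected V f)
  eared {zero} (extend {x = x} {y} {z} {e} (base {y = y₀} {z₀} j) e∈ je x∉ ja jb)
    with refl ← x∈⁅y⁆⇒x≡y _ e∈ =
    [] , [] , λ { [] → f , addEar-carries {f₀} {𝟏} {𝟐} cf₀ (λ ()) (λ ()) , ∂f , connected }
    where
    open Ear (base j) (x∈⁅x⁆ e) je x∉ ja jb
    f₀ = arc je 𝟏
    f = addEar f₀ 𝟏 𝟐
    cf₀ = carries-arc je {𝟏} λ ()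
    circular : ∀ p q r → 𝟏 ⊗ (p ⊖ q) ⊕ (𝟏 ⊗ (r ⊖ p) ⊕ 𝟐 ⊗ (r ⊖ q)) ≡ 𝟎
    circular = from-yes (∀₃? λ p → ∀₃? λ q → ∀₃? λ r → 𝟏 ⊗ (p ⊖ q) ⊕ (𝟏 ⊗ (r ⊖ p) ⊕ 𝟐 ⊗ (r ⊖ q)) ≟₃ 𝟎)
    ∂f : ∀ v → ∂ f v ≡ 𝟎
    ∂f v = trans (∂-addEar f₀ 𝟏 𝟐 v) (trans (cong (_⊕ (𝟏 ⊗ pair (x , y) v ⊕ 𝟐 ⊗ pair (x , z) v)) (∂-arc je 𝟏 v))
      (circular (δ y v) (δ z v) (δ x v)))
    yz : Arc f y z
    yz = forward je (trans (addEar-old {f₀} {𝟏} {𝟐} cf₀ (x∈⁅x⁆ e)) (arc-at je 𝟏))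
    xy : Arc f x y
    xy = forward ja (addEar-a {f₀} {𝟏} {𝟐} cf₀)
    zx : Arc f z x
    zx = backward jb (addEar-b {f₀} {𝟏} {𝟐} cf₀)
    vertex : ∀ {u} → u ∈ ⁅ y₀ ⁆ ∪ ⁅ z₀ ⁆ → u ≡ y ⊎ u ≡ z
    vertex u∈ with joins-unique j je | ∪-inj u∈
    ... | inj₁ (refl , refl) | inj₁ u∈y = inj₁ (x∈⁅y⁆⇒x≡y _ u∈y)
    ... | inj₁ (refl , refl) | inj₂ u∈z = inj₂ (x∈⁅y⁆⇒x≡y _ u∈z)
    ... | inj₂ (refl , refl) | inj₁ u∈z = inj₂ (x∈⁅y⁆⇒x≡y _ u∈z)
    ... | inj₂ (refl , refl) | inj₂ u∈y = inj₁ (x∈⁅y⁆⇒x≡y _ u∈y)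
    edge-connected : Connected (⁅ y₀ ⁆ ∪ ⁅ z₀ ⁆) f
    edge-connected u∈ v∈ with vertex u∈ | vertex v∈
    ... | inj₁ refl | inj₁ refl = ε
    ... | inj₁ refl | inj₂ refl = yz ◅ ε
    ... | inj₂ refl | inj₁ refl = zx ◅ xy ◅ ε
    ... | inj₂ refl | inj₂ refl = ε
    connected = connected-ear edge-connected z∈ y∈ zx xy
  eared {suc m} (extend {V = V} {E} {x} {y} {z} {a = a} {b} T e∈ je x∉ ja jb) =
    let (ps , ps≢ , flows) = eared T in
    (y , z) ∷ ps , joins-≢ je ∷ ps≢ , λ { (s ∷ ss) → add {comb (Vec.map pair ps) ss} s (flows ss) }
    where
    open Ear T e∈ je x∉ ja jb
    add : ∀ {β : Vertex → 𝔽₃} s → (∃ λ f → Carries E f × (∀ v → ∂ f v ≡ β v) × Connected V f) →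
      ∃ λ f → Carries (E ∪ ⁅ a ⁆ ∪ ⁅ b ⁆) f × (∀ v → ∂ f v ≡ signed s ⊗ pair (y , z) v ⊕ β v) × Connected (V ∪ ⁅ x ⁆) f
    add {β} s (f , cf , ∂f , conn) =
      -- The amount `signed s` runs along the path y x z: `x` stays balanced, and the boundary gains
      -- that multiple of y - z.
      addEar f (⊝ signed s) (signed s) ,
      addEar-carries {f} {⊝ signed s} {signed s} cf (⊗-nonzero {𝟐} (λ ()) (signed≢𝟎 s)) (signed≢𝟎 s) ,
      (λ v → trans (∂-addEar f (⊝ signed s) (signed s) v)
        (trans (cong (_⊕ (⊝ signed s ⊗ pair (x , y) v ⊕ signed s ⊗ pair (x , z) v)) (∂f v))
               (through (β v) (signed s) (δ x v) (δ y v) (δ z v)))) ,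
      ear s refl
      where
      through : ∀ b s p q r → b ⊕ (⊝ s ⊗ (p ⊖ q) ⊕ s ⊗ (p ⊖ r)) ≡ s ⊗ (q ⊖ r) ⊕ b
      through = from-yes (∀₃? λ b → ∀₃? λ s → ∀₃? λ p → ∀₃? λ q → ∀₃? λ r →
        b ⊕ (⊝ s ⊗ (p ⊖ q) ⊕ s ⊗ (p ⊖ r)) ≟₃ s ⊗ (q ⊖ r) ⊕ b)
      old : Connected V (addEar f (⊝ signed s) (signed s))
      old = connected-mono cf (addEar-old {f} {⊝ signed s} {signed s} cf) conn
      ear : ∀ s′ → s′ ≡ s → Connected (V ∪ ⁅ x ⁆) (addEar f (⊝ signed s) (signed s))
      ear true  refl = connected-ear old y∈ z∈ (backward ja (addEar-a {f} {𝟐} {𝟏} cf)) (forward jb (addEar-b {f} {𝟐} {𝟏} cf))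
      ear false refl = connected-ear old z∈ y∈ (backward jb (addEar-b {f} {𝟏} {𝟐} cf)) (forward ja (addEar-a {f} {𝟏} {𝟐} cf))

  free-edges : (es : List Edge) → Unique es → ∀ ss → ∃ λ f →
    (∀ {e} → e ∈.∈ es → f e ≢ 𝟎) × (∀ {e} → e ∈.∉ es → f e ≡ 𝟎) ×
    (∀ v → ∂ f v ≡ comb (Vec.map pair (Vec.map ends (Vec.fromList es))) ss v)
  free-edges []       _              []       = (λ _ → 𝟎) , (λ ()) , (λ _ → refl) , λ v → 𝔽Σ.sum-replicate-zero ∣E∣
  free-edges (e ∷ es) (e∉ ∷ unique) (s ∷ ss) =
    let (f , f-on , f-off , ∂f) = free-edges es unique ss in
    arc j (signed s) ⊞ f , on′ f f-on f-off , off′ f f-off ,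
    λ v → trans (∂-⊞ (arc j (signed s)) f v) (cong₂ _⊕_ (∂-arc j (signed s) v) (∂f v))
    where
    j : Joins e (proj₁ (ends e)) (proj₂ (ends e))
    j = inj₁ refl
    on′ : ∀ f → (∀ {e} → e ∈.∈ es → f e ≢ 𝟎) → (∀ {e} → e ∈.∉ es → f e ≡ 𝟎) →
          ∀ {e′} → e′ ∈.∈ e ∷ es → (arc j (signed s) ⊞ f) e′ ≢ 𝟎
    on′ f f-on f-off (here refl) eq = ⊗-nonzero (signed≢𝟎 s) (sgn≢𝟎 j)
      (trans (sym (trans (cong₂ _⊕_ (arc-at j (signed s)) (f-off λ e∈ → All.lookup e∉ e∈ refl)) (⊕-identityʳ _))) eq)
    on′ f f-on f-off {e′} (there e′∈) eq = f-on e′∈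
      (trans (sym (cong (_⊕ f e′) (arc-off j (signed s) (All.lookup e∉ e′∈)))) eq)
    off′ : ∀ f → (∀ {e} → e ∈.∉ es → f e ≡ 𝟎) → ∀ {e′} → e′ ∈.∉ e ∷ es → (arc j (signed s) ⊞ f) e′ ≡ 𝟎
    off′ f f-off e′∉ = cong₂ _⊕_ (arc-off j (signed s) λ { refl → e′∉ (here refl) }) (f-off (e′∉ ∘ there))

  others : Subset ∣E∣ → List Edge
  others E = List.filter (λ e → ¬? (e ∈? E)) (List.allFin ∣E∣)

  others-free : ∀ E ss → ∃ λ f → Carries (∁ E) f ×
    (∀ v → ∂ f v ≡ comb (Vec.map pair (Vec.map ends (Vec.fromList (others E)))) ss v)
  others-free E ss =
    let (f , f-on , f-off , ∂f) = free-edges (others E) (filter⁺ (λ e → ¬? (e ∈? E)) (allFin⁺ ∣E∣)) ss in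
    f , record
      { on  = λ {e} e∈ → f-on (∈-filter⁺ (λ e → ¬? (e ∈? E)) (∈.∈-allFin e) (x∈∁p⇒x∉p e∈))
      ; off = λ e∉ → f-off λ e∈ → e∉ (x∉p⇒x∈∁p (proj₂ (∈.∈-filter⁻ (λ e → ¬? (e ∈? E)) {xs = List.allFin ∣E∣} e∈)))
      } , ∂f

  -- Gluing the two trees and the remaining edges

  sum-∂ : ∀ f → Σ₃ (∂ f) ≡ 𝟎
  sum-∂ f = begin
    Σ₃ (∂ f)                                     ≡⟨ 𝔽Σ.∑-comm (λ v e → f e ⊗ inc e v) ⟩
    Σ₃ (λ e → Σ₃ λ v → f e ⊗ inc e v)            ≡⟨ 𝔽Σ.sum-cong-≗ balanced ⟩
    Σ₃ {∣E∣} (λ _ → 𝟎)                           ≡⟨ 𝔽Σ.sum-replicate-zero ∣E∣ ⟩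
    𝟎                                            ∎
    where
    open ≡-Reasoning
    Σδ : ∀ u → Σ₃ (δ u) ≡ 𝟏
    Σδ u = trans (Σ₃-single u (δ u) λ v v≢u → δ-≢ (v≢u ∘ sym)) (δ-refl u)
    Σ⊝δ : ∀ u → Σ₃ (λ v → ⊝ δ u v) ≡ 𝟐
    Σ⊝δ u = trans (Σ₃-single u (λ v → ⊝ δ u v) λ v v≢u → cong ⊝_ (δ-≢ (v≢u ∘ sym))) (cong ⊝_ (δ-refl u))
    balanced : ∀ e → Σ₃ (λ v → f e ⊗ inc e v) ≡ 𝟎
    balanced e = trans (sym (𝔽Σ.*-distribˡ-sum (f e) (inc e)))
      (trans (cong (f e ⊗_) (trans (𝔽Σ.∑-distrib-+ (δ (proj₁ (ends e))) (λ v → ⊝ δ (proj₂ (ends e)) v))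
                                   (cong₂ _⊕_ (Σδ (proj₁ (ends e))) (Σ⊝δ (proj₂ (ends e))))))
             (⊗-zeroʳ (f e)))

  FlowIndex<3 : Set
  FlowIndex<3 = ∃ λ r → IsFlowIndex G r × r ℚ.< (+ 3) / 1

  -- The three supports partition the edges, so the sum is nowhere zero, and balance at `r` follows
  -- from balance elsewhere. Connectivity may use the values on both trees, because in the
  -- four-vertex case `T₂` alone is not strong.
  conclude : ∀ {E₁ E₂ f₁ f₂ f₃ r} → Empty (E₁ ∩ E₂) → Carries E₁ f₁ → Carries E₂ f₂ → Carries (∁ (E₁ ∪ E₂)) f₃ →
    (∀ {v} → v ≢ r → ∂ f₁ v ⊕ ∂ f₂ v ⊕ ∂ f₃ v ≡ 𝟎) →
    ((∀ {e} → e ∈ E₁ → (f₁ ⊞ f₂ ⊞ f₃) e ≡ f₁ e) → (∀ {e} → e ∈ E₂ → (f₁ ⊞ f₂ ⊞ f₃) e ≡ f₂ e) →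
      ∀ u v → Star (Arc (f₁ ⊞ f₂ ⊞ f₃)) u v) →
    FlowIndex<3
  conclude {E₁} {E₂} {f₁} {f₂} {f₃} {r} disjoint c₁ c₂ c₃ balanced connected =
    Lifting.flowIndex<3 f nowhere-zero ∂f≡𝟎 (connected at₁ at₂)
    where
    f = f₁ ⊞ f₂ ⊞ f₃
    c₁₂ : Carries (E₁ ∪ E₂) (f₁ ⊞ f₂)
    c₁₂ = carries-⊞ c₁ c₂ λ e∈₁ e∈₂ → disjoint (_ , x∈p∩q⁺ (e∈₁ , e∈₂))
    f₃-off : ∀ {e} → e ∈ E₁ ∪ E₂ → f₃ e ≡ 𝟎
    f₃-off e∈ = off c₃ λ e∈∁ → x∈∁p⇒x∉p e∈∁ e∈
    at₁ : ∀ {e} → e ∈ E₁ → f e ≡ f₁ e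
    at₁ {e} e∈ rewrite f₃-off (x∈p∪q⁺ (inj₁ e∈)) | off c₂ {e} (λ e∈₂ → disjoint (_ , x∈p∩q⁺ (e∈ , e∈₂))) =
      trans (⊕-identityʳ _) (⊕-identityʳ _)
    at₂ : ∀ {e} → e ∈ E₂ → f e ≡ f₂ e
    at₂ {e} e∈ rewrite f₃-off (x∈p∪q⁺ {p = E₁} (inj₂ e∈)) | off c₁ {e} (λ e∈₁ → disjoint (_ , x∈p∩q⁺ (e∈₁ , e∈))) =
      ⊕-identityʳ _
    nowhere-zero : ∀ e → f e ≢ 𝟎
    nowhere-zero e with e ∈? (E₁ ∪ E₂)
    ... | yes e∈ = on c₁₂ e∈ ∘ trans (sym (trans (cong ((f₁ ⊞ f₂) e ⊕_) (f₃-off e∈)) (⊕-identityʳ _)))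
    ... | no  e∉ = on c₃ (x∉p⇒x∈∁p e∉) ∘ trans (sym (cong (_⊕ f₃ e) (off c₁₂ e∉)))
    off-root≡𝟎 : ∀ v → v ≢ r → ∂ f v ≡ 𝟎
    off-root≡𝟎 v v≢r = trans (∂-⊞ (f₁ ⊞ f₂) f₃ v) (trans (cong (_⊕ ∂ f₃ v) (∂-⊞ f₁ f₂ v)) (balanced v≢r))
    ∂f≡𝟎 : ∀ v → ∂ f v ≡ 𝟎
    ∂f≡𝟎 v with v ≟ r
    ... | no  v≢r  = off-root≡𝟎 v v≢r
    ... | yes refl = trans (sym (Σ₃-single v (∂ f) off-root≡𝟎)) (sum-∂ f)

  comb-empty : ℓ ≡ 0 → ∀ (us : Vec _ ℓ) ss v → comb us ss v ≡ 𝟎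
  comb-empty refl [] [] v = refl

  sum-empty : ℓ ≡ 0 → (ns : Vec ℕ ℓ) → Vec.sum ns ≡ 0
  sum-empty refl [] = refl

  heavy : (T : TwoTree k V E) → (∀ v → v ∈ V) → (ps : Vec (Vertex × Vertex) ℓ) → VAll (λ (a , b) → a ≢ b) ps →
    count (Vec.map (residue T) (Vec.map pair ps)) ≡ 0 → 2 ℕ.* ℓ ℕ.≤ Vec.sum (Vec.map (weight T) (Vec.map pair ps))
  heavy T full₁ []       []           _   = ℕ.z≤n
  heavy {ℓ = suc ℓ} T full₁ ((a , b) ∷ ps) (a≢b ∷ ps≢) r≡0 with pair-coordinates T (full₁ a) (full₁ b) a≢b
  ... | inj₁ r≢𝟎 = contradiction (nonzero≡0 (ℕ.m+n≡0⇒m≡0 _ r≡0)) r≢𝟎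
  ... | inj₂ w≥2 = ℕ.≤-trans (ℕ.≤-reflexive (ℕ.*-suc 2 ℓ)) (ℕ.+-mono-≤ w≥2 (heavy T full₁ ps ps≢ (ℕ.m+n≡0⇒n≡0 (nonzero (residue T (pair (a , b)))) r≡0)))

  -- Here `m` counts the ears of the second tree beyond its first triangle, `n` the edges outside
  -- both trees, and `suc m` the triangles of the first tree.
  few : ∀ m n → m ℕ.+ n ≢ 0 → 2 ℕ.* (m ℕ.+ n) ℕ.≤ suc m → m ≡ 1 × n ≡ 0
  few zero zero ≢0 _ = contradiction refl ≢0
  few zero (suc n) _ (ℕ.s≤s le) = case ℕ.n≤0⇒n≡0 (ℕ.≤-trans (ℕ.m≤n+m (suc (n ℕ.+ 0)) n) le) of λ ()
  few (suc zero) zero _ _ = refl , refl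
  few (suc zero) (suc n) _ (ℕ.s≤s (ℕ.s≤s le)) = case ℕ.n≤0⇒n≡0 (ℕ.≤-trans (ℕ.m≤n+m _ n) le) of λ ()
  few (suc (suc m)) n _ le = contradiction le (ℕ.<⇒≱ (subst (3 ℕ.+ m ℕ.<_) (eq m n) (ℕ.m≤m+n (4 ℕ.+ m) (m ℕ.+ 2 ℕ.* n))))
    where
    eq : ∀ m n → 4 ℕ.+ m ℕ.+ (m ℕ.+ 2 ℕ.* n) ≡ 2 ℕ.* (2 ℕ.+ m ℕ.+ n)
    eq = ℕ-solve-∀

  others-pairs : ∀ E → Vec (Vertex × Vertex) (List.length (others E))
  others-pairs E = Vec.map ends (Vec.fromList (others E))

  pairs≢ : (es : List Edge) → VAll (λ (a , b) → a ≢ b) (Vec.map ends (Vec.fromList es))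
  pairs≢ []       = []
  pairs≢ (e ∷ es) = loopless e ∷ pairs≢ es

  module _ {V₁ V₂ : Subset ∣V∣} {E₁ E₂ : Subset ∣E∣} {m : ℕ} (disjoint : Empty (E₁ ∩ E₂)) (T₂ : TwoTree (suc m) V₂ E₂)
           (full₁ : ∀ v → v ∈ V₁) (full₂ : ∀ v → v ∈ V₂) where

    pairs : Vec (Vertex × Vertex) (m ℕ.+ List.length (others (E₁ ∪ E₂)))
    pairs = proj₁ (eared T₂) Vec.++ others-pairs (E₁ ∪ E₂)

    finish : ∀ {r} ss → Sol V₁ E₁ r (comb (Vec.map pair pairs) ss) → FlowIndex<3
    finish ss (f₁ , c₁ , ∂f₁) with Vec.splitAt m ss
    ... | s₂ , s₃ , refl =
      let (f₂ , c₂ , ∂f₂ , conn) = proj₂ (proj₂ (eared T₂)) s₂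
          (f₃ , c₃ , ∂f₃) = others-free (E₁ ∪ E₂) s₃
      -- The first tree was solved for the boundary of all other edges; the factor `𝟐`, which is -1,
      -- makes the two cancel and keeps the values nonzero.
      in conclude disjoint (carries-scale {c = 𝟐} (λ ()) c₁) c₂ c₃
           (λ {v} v≢r → trans (cong₂ _⊕_ (cong₂ _⊕_ (trans (∂-scale 𝟐 f₁ v) (cong (𝟐 ⊗_)
                (trans (∂f₁ (full₁ v) v≢r) (split v s₂ s₃)))) (∂f₂ v)) (∂f₃ v))
              (cancel (comb (Vec.map pair (proj₁ (eared T₂))) s₂ v) (comb (Vec.map pair (others-pairs (E₁ ∪ E₂))) s₃ v)))
           (λ _ at₂ u v → connected-mono c₂ at₂ conn (full₂ u) (full₂ v))
      where
      cancel : ∀ p q → 𝟐 ⊗ (p ⊕ q) ⊕ p ⊕ q ≡ 𝟎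
      cancel = from-yes (∀₃? λ p → ∀₃? λ q → 𝟐 ⊗ (p ⊕ q) ⊕ p ⊕ q ≟₃ 𝟎)
      split : ∀ v s₂ s₃ → comb (Vec.map pair pairs) (s₂ Vec.++ s₃) v ≡
        comb (Vec.map pair (proj₁ (eared T₂))) s₂ v ⊕ comb (Vec.map pair (others-pairs (E₁ ∪ E₂))) s₃ v
      split v s₂ s₃ = trans (cong (λ us → comb us (s₂ Vec.++ s₃) v) (Vec.map-++ pair (proj₁ (eared T₂)) (others-pairs (E₁ ∪ E₂))))
        (comb-++ (Vec.map pair (proj₁ (eared T₂))) _ s₂ s₃ v)

    generic : TwoTree (suc m) V₁ E₁ → FlowIndex<3 ⊎ (m ≡ 1 × List.length (others (E₁ ∪ E₂)) ≡ 0)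
    generic T₁ with count (Vec.map (residue T₁) (Vec.map pair pairs)) ℕ.≟ 0
                  | Vec.sum (Vec.map (weight T₁) (Vec.map pair pairs)) ℕ.≟ suc m
    ... | no r≢0 | _ = let (ss , good) = select T₁ (Vec.map pair pairs) (inj₁ r≢0) in
      inj₁ (finish ss (good⇒sol T₁ good))
    ... | yes _ | no w≢ = let (ss , good) = select T₁ (Vec.map pair pairs) (inj₂ w≢) in
      inj₁ (finish ss (good⇒sol T₁ good))
    ... | yes r≡0 | yes w≡ = inj₂ (few m _
      (λ ℓ≡0 → case trans (sym w≡) (sum-empty ℓ≡0 (Vec.map (weight T₁) (Vec.map pair pairs))) of λ ())
      (subst (_ ℕ.≤_) w≡ (heavy T₁ full₁ pairs (VAll.++⁺ (proj₁ (proj₂ (eared T₂))) (pairs≢ (others (E₁ ∪ E₂)))) r≡0)))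

  -- The exceptional case of four vertices

  record Rooted (V : Subset ∣V∣) (E : Subset ∣E∣) (e : Edge) (y z : Vertex) : Set where
    field
      {w} : Vertex
      {a b} : Edge
      w∉ : w ∉ ⁅ y ⁆ ∪ ⁅ z ⁆
      joins-a : Joins a w y
      joins-b : Joins b w z
      V≡ : V ≡ (⁅ y ⁆ ∪ ⁅ z ⁆) ∪ ⁅ w ⁆
      E≡ : E ≡ ⁅ e ⁆ ∪ ⁅ a ⁆ ∪ ⁅ b ⁆

  module ∪V = CommutativeMonoidSolver (∪-commutativeMonoid ∣V∣)
  module ∪E = CommutativeMonoidSolver (∪-commutativeMonoid ∣E∣)

  ∉-pair : ∀ {u v w : Vertex} → w ≢ u → w ≢ v → w ∉ ⁅ u ⁆ ∪ ⁅ v ⁆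
  ∉-pair w≢u w≢v w∈ with ∪-inj w∈
  ... | inj₁ w∈u = w≢u (x∈⁅y⁆⇒x≡y _ w∈u)
  ... | inj₂ w∈v = w≢v (x∈⁅y⁆⇒x≡y _ w∈v)

  rooted-sym : ∀ {V E e y z} → Rooted V E e y z → Rooted V E e z y
  rooted-sym {y = y} {z} R = record
    { w∉ = subst (_ ∉_) (∪-comm ⁅ y ⁆ ⁅ z ⁆) (R .w∉)
    ; joins-a = R .joins-b
    ; joins-b = R .joins-a
    ; V≡ = trans (R .V≡) (cong (_∪ ⁅ R .w ⁆) (∪-comm ⁅ y ⁆ ⁅ z ⁆))
    ; E≡ = trans (R .E≡) (cong (⁅ _ ⁆ ∪_) (∪-comm ⁅ R .a ⁆ ⁅ R .b ⁆))
    }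
    where open Rooted

  rooted-along : ∀ {V E e y z u v} → Rooted V E e y z → Joins e y z → Joins e u v → Rooted V E e u v
  rooted-along R j j′ with joins-unique j j′
  ... | inj₁ (refl , refl) = R
  ... | inj₂ (refl , refl) = rooted-sym R

  -- Any edge of a triangle can serve as its base. Taking the edge under the second ear shows a tree
  -- with two triangles as two ears on one common edge.
  rooted : TwoTree 1 V E → ∀ {e y z} → e ∈ E → Joins e y z → Rooted V E e y z
  rooted (extend {x = x} {a = a} {b} (base {e₀} {y₀} {z₀} j) e₀∈ j₀ x∉ ja jb) {e} e∈ je
    with refl ← x∈⁅y⁆⇒x≡y e₀ e₀∈ | ∪-inj e∈ | reindex (joins-unique j j₀)
    where
    reindex : ∀ {u v} → (y₀ ≡ u × z₀ ≡ v) ⊎ (y₀ ≡ v × z₀ ≡ u) → x ∉ ⁅ u ⁆ ∪ ⁅ v ⁆ ×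
      (⁅ y₀ ⁆ ∪ ⁅ z₀ ⁆) ∪ ⁅ x ⁆ ≡ (⁅ u ⁆ ∪ ⁅ v ⁆) ∪ ⁅ x ⁆
    reindex (inj₁ (refl , refl)) = x∉ , refl
    reindex (inj₂ (refl , refl)) = subst (x ∉_) (∪-comm ⁅ y₀ ⁆ ⁅ z₀ ⁆) x∉ , cong (_∪ ⁅ x ⁆) (∪-comm ⁅ y₀ ⁆ ⁅ z₀ ⁆)
  ... | inj₁ e∈₀ | x∉′ , V≡ with refl ← x∈⁅y⁆⇒x≡y e₀ e∈₀ = rooted-along record
        { w∉ = x∉′ ; joins-a = ja ; joins-b = jb ; V≡ = V≡ ; E≡ = refl } j₀ je
  ... | inj₂ e∈ab | x∉′ , V≡ with ∪-inj e∈ab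
  ...   | inj₁ e∈a with refl ← x∈⁅y⁆⇒x≡y a e∈a = rooted-along record
            { w∉ = ∉-pair (joins-≢ jb ∘ sym) (joins-≢ j₀ ∘ sym)
            ; joins-a = joins-sym jb
            ; joins-b = joins-sym j₀
            ; V≡ = trans V≡ (∪V.solve 3 (λ y z x → ((y ∪V.⊕ z) ∪V.⊕ x) ∪V.⊜ ((x ∪V.⊕ y) ∪V.⊕ z)) refl _ _ _)
            ; E≡ = ∪E.solve 3 (λ e a b → (e ∪E.⊕ (a ∪E.⊕ b)) ∪E.⊜ (a ∪E.⊕ (b ∪E.⊕ e))) refl _ _ _
            } ja je
  ...   | inj₂ e∈b with refl ← x∈⁅y⁆⇒x≡y b e∈b = rooted-along record
            { w∉ = ∉-pair (joins-≢ ja ∘ sym) (joins-≢ j₀)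
            ; joins-a = joins-sym ja
            ; joins-b = j₀
            ; V≡ = trans V≡ (∪V.solve 3 (λ y z x → ((y ∪V.⊕ z) ∪V.⊕ x) ∪V.⊜ ((x ∪V.⊕ z) ∪V.⊕ y)) refl _ _ _)
            ; E≡ = ∪E.solve 3 (λ e a b → (e ∪E.⊕ (a ∪E.⊕ b)) ∪E.⊜ (b ∪E.⊕ (a ∪E.⊕ e))) refl _ _ _
            } jb je

  -- The one exception to the count: two triangle-trees with two triangles each and
  -- no further edges, i.e. four vertices.
  four-vertices : ∀ {V₁ V₂ E₁ E₂} → Empty (E₁ ∩ E₂) → TwoTree 2 V₁ E₁ → TwoTree 2 V₂ E₂ →
    (∀ v → v ∈ V₁) → (∀ v → v ∈ V₂) → List.length (others (E₁ ∪ E₂)) ≡ 0 → FlowIndex<3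
  four-vertices {E₁ = E₁} {E₂} disjoint T₁@(extend {V = V₁′} {E₁′} {x} {y} {z} {e} {a} {b} T₁′ e∈ je x∉ ja jb)
    T₂@(extend {V = V₂′} {E₂′} {x₂} {p} {q} T₂′ e₂∈ j₂ x₂∉ ja₂ jb₂) full₁ full₂ none
    with record { w = w ; a = a′ ; b = b′ ; w∉ = w∉ ; joins-a = ja′ ; joins-b = jb′ ; V≡ = refl ; E≡ = refl } ← rooted T₁′ e∈ je =
    -- The boundary to absorb is the single term ±(p - q). If it misses `x` or `w`, the ear there
    -- has zero demand. Otherwise it is ±(x - w), the difference of the two triangles of `T₁`, so
    -- both signs are bad and `T₂` needs another orientation.
    by-ear (x ≟ p) (x ≟ q) (w ≟ p) (w ≟ q)
    where
    x∉yz : x ∉ ⁅ y ⁆ ∪ ⁅ z ⁆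
    x∉yz = x∉ ∘ x∈p∪q⁺ ∘ inj₁

    x≢w : x ≢ w
    x≢w refl = x∉ (x∈p∪q⁺ (inj₂ (x∈⁅x⁆ w)))

    w∉′ : w ∉ (⁅ y ⁆ ∪ ⁅ z ⁆) ∪ ⁅ x ⁆
    w∉′ w∈ with ∪-inj w∈
    ... | inj₁ w∈yz = w∉ w∈yz
    ... | inj₂ w∈x  = x≢w (sym (x∈⁅y⁆⇒x≡y x w∈x))

    -- Both ears sit on `e`, so their order can be exchanged; with `w` last, a zero demand at `w` is
    -- enough for `Good`.
    T₁* : TwoTree 2 (((⁅ y ⁆ ∪ ⁅ z ⁆) ∪ ⁅ x ⁆) ∪ ⁅ w ⁆) ((⁅ e ⁆ ∪ ⁅ a ⁆ ∪ ⁅ b ⁆) ∪ ⁅ a′ ⁆ ∪ ⁅ b′ ⁆)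
    T₁* = extend (extend (base je) (x∈⁅x⁆ e) je x∉yz ja jb) (x∈p∪q⁺ (inj₁ (x∈⁅x⁆ e))) je w∉′ ja′ jb′

    full₁* : ∀ v → v ∈ ((⁅ y ⁆ ∪ ⁅ z ⁆) ∪ ⁅ x ⁆) ∪ ⁅ w ⁆
    full₁* v = subst (v ∈_) (∪V.solve 3 (λ p q r → ((p ∪V.⊕ q) ∪V.⊕ r) ∪V.⊜ ((p ∪V.⊕ r) ∪V.⊕ q)) refl
      (⁅ y ⁆ ∪ ⁅ z ⁆) ⁅ w ⁆ ⁅ x ⁆) (full₁ v)

    E₁≡ : (⁅ e ⁆ ∪ ⁅ a ⁆ ∪ ⁅ b ⁆) ∪ ⁅ a′ ⁆ ∪ ⁅ b′ ⁆ ≡ (⁅ e ⁆ ∪ ⁅ a′ ⁆ ∪ ⁅ b′ ⁆) ∪ ⁅ a ⁆ ∪ ⁅ b ⁆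
    E₁≡ = ∪E.solve 3 (λ p q r → ((p ∪E.⊕ q) ∪E.⊕ r) ∪E.⊜ ((p ∪E.⊕ r) ∪E.⊕ q)) refl
      ⁅ e ⁆ (⁅ a ⁆ ∪ ⁅ b ⁆) (⁅ a′ ⁆ ∪ ⁅ b′ ⁆)

    ps : Vec (Vertex × Vertex) _
    ps = pairs disjoint T₂ full₁ full₂

    signs : Vec Bool _
    signs = Vec.replicate _ true

    missed : ∀ {v} → v ≢ p → v ≢ q → comb (Vec.map pair ps) signs v ≡ 𝟎
    missed {v} v≢p v≢q = cong₂ _⊕_ (cong₂ _⊖_ (δ-≢ (v≢p ∘ sym)) (δ-≢ (v≢q ∘ sym)))
      (comb-empty none (Vec.map pair (proj₁ (eared T₂′) Vec.++ others-pairs (E₁ ∪ E₂))) (Vec.replicate _ true) v)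

    x-missed : x ≢ p → x ≢ q → FlowIndex<3
    x-missed x≢p x≢q = finish disjoint T₂ full₁ full₂ signs (good⇒sol T₁ (inj₁ (missed x≢p x≢q)))

    w-missed : w ≢ p → w ≢ q → FlowIndex<3
    w-missed w≢p w≢q = finish disjoint T₂ full₁* full₂ signs
      (subst (λ E → Sol _ E (root T₁*) (comb (Vec.map pair ps) signs)) E₁≡ (good⇒sol T₁* (inj₁ (missed w≢p w≢q))))

    -- Both edges of the ear x₂ point into x₂, and T₁ leads from x₂ to the opposite
    -- vertex of its edge yz.
    module Explicit (c : 𝔽₃) (c≢𝟎 : c ≢ 𝟎) where
      open Ear (base je) (x∈⁅x⁆ e) je w∉ ja′ jb′ using () renaming
        (addEar to addW; addEar-carries to addW-carries; addEar-old to addW-old; ∂-addEar to ∂-addW)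
      open Ear T₁′ e∈ je x∉ ja jb using () renaming
        (addEar to addX; addEar-carries to addX-carries; addEar-old to addX-old; ∂-addEar to ∂-addX)
      module E₂ = Ear T₂′ e₂∈ j₂ x₂∉ ja₂ jb₂

      -- In both applications `x₂` is an end of `e`, and `c` directs `e` away from it. Each of `x`
      -- and `w` sends 1 to `y`, to `z` and to `x₂`. The circuit of `T₂` aside, the net outflow is 3
      -- at `x` and `w` and -3 at `y` and `z`.
      f₀ = arc je c
      f₁′ = addW f₀ 𝟏 𝟏
      f₁ = addX f₁′ 𝟏 𝟏

      c₀ : Carries ⁅ e ⁆ f₀
      c₀ = carries-arc je c≢𝟎

      c₁′ : Carries (⁅ e ⁆ ∪ ⁅ a′ ⁆ ∪ ⁅ b′ ⁆) f₁′
      c₁′ = addW-carries {f₀} {𝟏} {𝟏} c₀ (λ ()) (λ ())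

      c₁ : Carries E₁ f₁
      c₁ = addX-carries {f₁′} {𝟏} {𝟏} c₁′ (λ ()) (λ ())

      circuit = proj₂ (proj₂ (eared T₂′)) []
      f₂′ = proj₁ circuit
      c₂′ = proj₁ (proj₂ circuit)
      f₂ = E₂.addEar f₂′ 𝟐 𝟐

      c₂ : Carries E₂ f₂
      c₂ = E₂.addEar-carries {f₂′} {𝟐} {𝟐} c₂′ (λ ()) (λ ())

      rest = others-free (E₁ ∪ E₂) (Vec.replicate _ true)

      leaf : Vertex → Vertex → 𝔽₃
      leaf u v = 𝟏 ⊗ pair (u , y) v ⊕ 𝟏 ⊗ pair (u , z) v

      ∂f₁ : ∀ v → ∂ f₁ v ≡ c ⊗ pair (y , z) v ⊕ leaf w v ⊕ leaf x v
      ∂f₁ v = trans (∂-addX f₁′ 𝟏 𝟏 v) (cong (_⊕ leaf x v)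
        (trans (∂-addW f₀ 𝟏 𝟏 v) (cong (_⊕ leaf w v) (∂-arc je c v))))

      ∂f₂ : ∀ v → ∂ f₂ v ≡ 𝟐 ⊗ pair (x₂ , p) v ⊕ 𝟐 ⊗ pair (x₂ , q) v
      ∂f₂ v = trans (E₂.∂-addEar f₂′ 𝟐 𝟐 v) (cong (_⊕ (𝟐 ⊗ pair (x₂ , p) v ⊕ 𝟐 ⊗ pair (x₂ , q) v))
        (trans (proj₁ (proj₂ (proj₂ circuit)) v) (comb-empty refl (Vec.map pair (proj₁ (eared T₂′))) [] v)))

      at-e : ∀ (f : Edge → 𝔽₃) → (∀ {e} → e ∈ E₁ → f e ≡ f₁ e) → f e ≡ c ⊗ sgn je
      at-e f at₁ = trans (at₁ (x∈p∪q⁺ (inj₁ e∈))) (trans (addX-old {f₁′} {𝟏} {𝟏} c₁′ e∈)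
        (trans (addW-old {f₀} {𝟏} {𝟏} c₀ (x∈⁅x⁆ e)) (arc-at je c)))

      result : ∀ {o} → x₂ ≢ o →
        (∀ (f : Edge → 𝔽₃) → (∀ {e} → e ∈ E₁ → f e ≡ f₁ e) → Arc f x₂ o) →
        (x ≡ p × w ≡ q) ⊎ (x ≡ q × w ≡ p) →
        (∀ v → c ⊗ pair (y , z) v ⊕ leaf w v ⊕ leaf x v ⊕ (𝟐 ⊗ pair (x₂ , x) v ⊕ 𝟐 ⊗ pair (x₂ , w) v) ≡ 𝟎) →
        FlowIndex<3
      result {o} x₂≢o out xw identity = conclude {r = o} disjoint c₁ c₂ (proj₁ (proj₂ rest))
        (λ {v} _ → cong₂ _⊕_ (trans (cong₂ _⊕_ (∂f₁ v) (∂f₂ v)) (balanced xw v))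
          (trans (proj₂ (proj₂ rest) v) (comb-empty none (Vec.map pair (others-pairs (E₁ ∪ E₂))) (Vec.replicate _ true) v)))
        -- The directed triangle in `T₂` joins the other three vertices; `x₂` is entered from `p`
        -- and left along `e`, as if it were an ear.
        λ at₁ at₂ u v → connected-ear
          (connected-mono c₂′ (λ e∈ → trans (at₂ (x∈p∪q⁺ (inj₁ e∈))) (E₂.addEar-old {f₂′} {𝟐} {𝟐} c₂′ e∈)) (proj₂ (proj₂ (proj₂ circuit))))
          E₂.y∈ o∈ (backward ja₂ (trans (at₂ (x∈p∪q⁺ (inj₂ (x∈p∪q⁺ (inj₁ (x∈⁅x⁆ _)))))) (E₂.addEar-a {f₂′} {𝟐} {𝟐} c₂′)))
          (out (f₁ ⊞ f₂ ⊞ proj₁ rest) at₁) (full₂ u) (full₂ v)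
        where
        balanced : (x ≡ p × w ≡ q) ⊎ (x ≡ q × w ≡ p) → ∀ v →
          c ⊗ pair (y , z) v ⊕ leaf w v ⊕ leaf x v ⊕ (𝟐 ⊗ pair (x₂ , p) v ⊕ 𝟐 ⊗ pair (x₂ , q) v) ≡ 𝟎
        balanced (inj₁ (refl , refl)) v = identity v
        balanced (inj₂ (refl , refl)) v = trans
          (cong (c ⊗ pair (y , z) v ⊕ leaf w v ⊕ leaf x v ⊕_) (⊕-comm (𝟐 ⊗ pair (x₂ , w) v) (𝟐 ⊗ pair (x₂ , x) v)))
          (identity v)
        o∈ : o ∈ V₂′
        o∈ with ∪-inj (full₂ o)
        ... | inj₁ o∈V = o∈V
        ... | inj₂ o∈x₂ = contradiction (sym (x∈⁅y⁆⇒x≡y x₂ o∈x₂)) x₂≢o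

    y⇒z : x₂ ≡ y → (x ≡ p × w ≡ q) ⊎ (x ≡ q × w ≡ p) → FlowIndex<3
    y⇒z refl xw = result (joins-≢ je) (λ f at₁ → forward {f} je (at-e f at₁)) xw
      λ v → identity (δ y v) (δ z v) (δ w v) (δ x v)
      where
      open Explicit 𝟏 (λ ())
      identity : ∀ Y Z W X → 𝟏 ⊗ (Y ⊖ Z) ⊕ (𝟏 ⊗ (W ⊖ Y) ⊕ 𝟏 ⊗ (W ⊖ Z)) ⊕ (𝟏 ⊗ (X ⊖ Y) ⊕ 𝟏 ⊗ (X ⊖ Z)) ⊕
        (𝟐 ⊗ (Y ⊖ X) ⊕ 𝟐 ⊗ (Y ⊖ W)) ≡ 𝟎
      identity = from-yes (∀₃? λ Y → ∀₃? λ Z → ∀₃? λ W → ∀₃? λ X →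
        𝟏 ⊗ (Y ⊖ Z) ⊕ (𝟏 ⊗ (W ⊖ Y) ⊕ 𝟏 ⊗ (W ⊖ Z)) ⊕ (𝟏 ⊗ (X ⊖ Y) ⊕ 𝟏 ⊗ (X ⊖ Z)) ⊕
        (𝟐 ⊗ (Y ⊖ X) ⊕ 𝟐 ⊗ (Y ⊖ W)) ≟₃ 𝟎)

    z⇒y : x₂ ≡ z → (x ≡ p × w ≡ q) ⊎ (x ≡ q × w ≡ p) → FlowIndex<3
    z⇒y refl xw = result (joins-≢ je ∘ sym) (λ f at₁ → backward {f} je (at-e f at₁)) xw
      λ v → identity (δ y v) (δ z v) (δ w v) (δ x v)
      where
      open Explicit 𝟐 (λ ())
      identity : ∀ Y Z W X → 𝟐 ⊗ (Y ⊖ Z) ⊕ (𝟏 ⊗ (W ⊖ Y) ⊕ 𝟏 ⊗ (W ⊖ Z)) ⊕ (𝟏 ⊗ (X ⊖ Y) ⊕ 𝟏 ⊗ (X ⊖ Z)) ⊕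
        (𝟐 ⊗ (Z ⊖ X) ⊕ 𝟐 ⊗ (Z ⊖ W)) ≡ 𝟎
      identity = from-yes (∀₃? λ Y → ∀₃? λ Z → ∀₃? λ W → ∀₃? λ X →
        𝟐 ⊗ (Y ⊖ Z) ⊕ (𝟏 ⊗ (W ⊖ Y) ⊕ 𝟏 ⊗ (W ⊖ Z)) ⊕ (𝟏 ⊗ (X ⊖ Y) ⊕ 𝟏 ⊗ (X ⊖ Z)) ⊕
        (𝟐 ⊗ (Z ⊖ X) ⊕ 𝟐 ⊗ (Z ⊖ W)) ≟₃ 𝟎)

    crossing : (x ≡ p × w ≡ q) ⊎ (x ≡ q × w ≡ p) → FlowIndex<3
    crossing xw with ∪-inj (full₁ x₂)
    ... | inj₂ x₂∈x = contradiction (x∈⁅y⁆⇒x≡y x x₂∈x) (x₂≢x xw)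
      where
      x₂≢x : (x ≡ p × w ≡ q) ⊎ (x ≡ q × w ≡ p) → x₂ ≢ x
      x₂≢x (inj₁ (refl , _)) refl = joins-≢ ja₂ refl
      x₂≢x (inj₂ (refl , _)) refl = joins-≢ jb₂ refl
    ... | inj₁ x₂∈yzw with ∪-inj x₂∈yzw
    ...   | inj₂ x₂∈w = contradiction (x∈⁅y⁆⇒x≡y w x₂∈w) (x₂≢w xw)
      where
      x₂≢w : (x ≡ p × w ≡ q) ⊎ (x ≡ q × w ≡ p) → x₂ ≢ w
      x₂≢w (inj₁ (_ , refl)) refl = joins-≢ jb₂ refl
      x₂≢w (inj₂ (_ , refl)) refl = joins-≢ ja₂ refl
    ...   | inj₁ x₂∈yz with ∪-inj x₂∈yz
    ...     | inj₁ x₂∈y = y⇒z (x∈⁅y⁆⇒x≡y y x₂∈y) xw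
    ...     | inj₂ x₂∈z = z⇒y (x∈⁅y⁆⇒x≡y z x₂∈z) xw

    by-ear : Dec (x ≡ p) → Dec (x ≡ q) → Dec (w ≡ p) → Dec (w ≡ q) → FlowIndex<3
    by-ear (no x≢p)   (no x≢q)   _          _          = x-missed x≢p x≢q
    by-ear _          _          (no w≢p)   (no w≢q)   = w-missed w≢p w≢q
    by-ear (yes x≡p)  _          _          (yes w≡q)  = crossing (inj₁ (x≡p , w≡q))
    by-ear _          (yes x≡q)  (yes w≡p)  _          = crossing (inj₂ (x≡q , w≡p))
    by-ear (yes x≡p)  _          (yes w≡p)  _          = contradiction (trans x≡p (sym w≡p)) x≢w
    by-ear _          (yes x≡q)  _          (yes w≡q)  = contradiction (trans x≡q (sym w≡q)) x≢w

  card-full : (∀ v → v ∈ V) → card V ≡ ∣V∣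
  card-full {V} full-V = ℕ.≤-antisym (∣p∣≤n V)
    (ℕ.≤-trans (ℕ.≤-reflexive (sym (∣⊤∣≡n ∣V∣))) (p⊆q⇒∣p∣≤∣q∣ {p = full} (λ {v} _ → full-V v)))

  triangleTrees⇒flowIndex<3 : TwoEdgeDisjointSpanningTriangleTrees G → FlowIndex<3
  triangleTrees⇒flowIndex<3 (E₁ , E₂ , (V₁ , tree₁ , full₁) , (V₂ , tree₂ , full₂) , disjoint)
    with fromTriangleTree tree₁ | fromTriangleTree tree₂
  -- Both trees span, so they have the same number of vertices and hence of triangles.
  ... | m₁ , T₁ | m₂ , T₂ with refl ← ℕ.+-cancelˡ-≡ 3 m₁ m₂ (trans (sym (size T₁)) (trans (trans (card-full full₁) (sym (card-full full₂))) (size T₂)))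
    with generic disjoint T₂ full₁ full₂ T₁
  ...   | inj₁ done          = done
  ...   | inj₂ (refl , none) = four-vertices disjoint T₁ T₂ full₁ full₂ none

theorem1p8 : (G : Graph) → TwoEdgeDisjointSpanningTriangleTrees G →
    ∃ λ r → IsFlowIndex G r × r < (+ 3) / 1
theorem1p8 G = Trees.triangleTrees⇒flowIndex<3 G
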